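{- Let $n$ be a positive integer and let $k_1,\ldots,k_n$ be nonnegative integers. Let $\mathcal{L}(k_1,\ldots,k_n)$ be the collection of finite sequences of vectors of $V(M(n,k_1,\ldots,k_n))$ produced by the linear BTK algorithm (defined in the context). Then $\mathcal{L}(k_1,\ldots,k_n)$ is a symmetric Jordan basis of $V(M(n,k_1,\ldots,k_n))$ with respect to the up operator $U$; that is, each sequence in $\mathcal{L}(k_1,\ldots,k_n)$ is a symmetric Jordan chain with respect to $U$, and the vectors of all these sequences together form (as a disjoint union) a basis of $V(M(n,k_1,\ldots,k_n))$. Moreover, every vector in this basis has integral coefficients when expressed in the standard basis $M(n,k_1,\ldots,k_n)$.
   Context: Posets. $M(n,k_1,\ldots,k_n)=\{(x_1,\ldots,x_n)\in\mathbb{N}^n : 0\le x_i\le k_i \text{ for all } i\}$ (with $0\in\mathbb{N}$), partially ordered componentwise. It is graded with rank function $r(x_1,\ldots,x_n)=x_1+\cdots+x_n$; its rank is $r(P)=k_1+\cdots+k_n$. For a finite graded poset $P$ with rank function $r$, let $r(P)=\max_{p\in P} r(p)$, let $P_i$ be the set of elements of rank $i$, and for a finite set $S$ let $V(S)$ be the complex vector space with basis $S$. So $V(P)=\bigoplus_i V(P_i)$. A vector $v\in V(P)$ is homogeneous of rank $r(v)=i$ if $v\in V(P_i)$. The up operator $U:V(P)\to V(P)$ is the linear map with $U(p)=\sum_q q$, the sum over all $q$ covering $p$. Jordan chains. A graded Jordan chain is a sequence $(v_1,\ldots,v_h)$ of nonzero homogeneous vectors of $V(P)$ with $U(v_{i-1})=v_i$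 for $2\le i\le h$ and $U(v_h)=0$. It is a symmetric Jordan chain if in addition $r(v_1)+r(v_h)=r(P)$ (for $h=1$ this reads $2r(v_1)=r(P)$). A symmetric Jordan basis (SJB) is a basis of $V(P)$ that is a disjoint union of symmetric Jordan chains. The linear BTK algorithm. Step A (two factors). For integers $p,q\ge 0$ define recursively a collection $\mathcal{J}(p,q)$ of sequences of vectors of $V(M(2,p,q))$. If $p=0$ or $q=0$, then $M(2,p,q)$ is a chain and $\mathcal{J}(p,q)$ consists of the single sequence listing the elements of $M(2,p,q)$ in increasing order. If $p,q\ge 1$, then $\mathcal{J}(p,q)$ consists of: (1) the sequence $(v(0),v(1),\ldots,v(p+q))$, where $v(k)=\sum\binom{k}{i}(i,j)$, the sum over all $0\le i\le p$, $0\le j\le q$ with $i+j=k$; and (2) for each sequence $(w_1,\ldots,w_h)$ in $\mathcal{J}(p-1,q-1)$, the sequence $(\theta(w_1),\ldots,\theta(w_h))$, where $\theta:V(M(2,p-1,q-1))\to V(M(2,p,q))$ is the linear map with $\theta((i,j))=v(i,j+1)$, and $v(i,j)=(p-i)\,(i,j)-(q-j+1)\,(i+1,j-1)$ for $0\le i\le p-1$, $1\le j\le q$. Step B (general case, recursion on $n$). For $n=1$, $\mathcal{L}(k_1)$ consists of the single sequence $(0,1,\ldots,k_1)$ of elements of $M(1,k_1)$. For $n\ge 2$, let the sequences in $\mathcal{L}(k_1,\ldots,k_{n-1})$ be $(v(0,m),v(1,m),\ldots,v(l_m,m))$, $1\le m\le t$. For $0\le j\le k_n$ let $v(i,j,m)\in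 V(M(n,k_1,\ldots,k_n))$ be the image of $v(i,m)$ under the linear map with $(a_1,\ldots,a_{n-1})\mapsto(a_1,\ldots,a_{n-1},j)$. For each $m$ let $\psi_m:V(M(2,l_m,k_n))\to V(M(n,k_1,\ldots,k_n))$ be the linear map with $\psi_m((i,j))=v(i,j,m)$. Then $\mathcal{L}(k_1,\ldots,k_n)$ consists of all sequences $(\psi_m(w_1),\ldots,\psi_m(w_h))$ with $1\le m\le t$ and $(w_1,\ldots,w_h)\in\mathcal{J}(l_m,k_n)$. -}

module Defs where

open import Algebra.Apartness.Bundles using (HeytingField; HeytingCommutativeRing)
open import Algebra.Bundles using (CommutativeRing)
open import Data.Bool using (if_then_else_)
open import Data.Empty using (⊥-elim)
open import Data.Fin as Fin using (Fin; toℕ; fromℕ; inject₁)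
import Data.Fin.Properties as Fin
open import Data.Integer using (ℤ; +_; -[1+_])
open import Data.List using (List; []; _∷_; map; concatMap; filter; cartesianProduct; allFin; foldr; length; lookup)
open import Data.List.Membership.Propositional using (_∈_)
open import Data.List.Membership.Propositional.Properties using (∈-cartesianProduct⁺; ∈-allFin)
open import Data.List.Relation.Unary.All as All using (All)
open import Data.List.Relation.Unary.Any using (here)
open import Data.List.Relation.Unary.AllPairs using ([]; _∷_)
open import Data.List.Relation.Unary.Unique.Propositional using (Unique)
open import Data.List.Relation.Unary.Unique.Propositional.Properties using (cartesianProduct⁺; allFin⁺)
open import Data.Nat as ℕ using (ℕ; zero; suc; _∸_; _⊔_)
open import Data.Nat.Combinatorics using (_C_)
import Data.Nat.Properties as ℕ
open import Data.Product using (∃; _×_; _,_; proj₁; proj₂)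
open import Data.Product.Properties using (≡-dec)
open import Data.Sum using (inj₁; inj₂)
open import Data.Unit using (⊤; tt)
open import Data.Vec.Functional as Vector using (Vector; init; last)
open import Function using (_∘_)
import Level
open import Relation.Binary using (Rel; Decidable; IsDecPartialOrder)
import Relation.Binary.Construct.NonStrictToStrict as ToStrict
open import Relation.Binary.PropositionalEquality
  using (_≡_; _≢_; refl; sym; trans; cong; cong₂; isEquivalence)
open import Relation.Nullary using (¬_; yes; no; does)
open import Relation.Nullary.Decidable using (¬?; _×-dec_; map′)

------------------------------------------------------------------------
-- Finite graded posets

module Covering {A : Set} (_≤_ : Rel A Level.0ℓ) where

  open ToStrict _≡_ _≤_ public using (_<_)

  infix 4 _⋖_

  -- p ⋖ q : q covers p
  _⋖_ : Rel A Level.0ℓ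
  p ⋖ q = p < q × (∀ z → ¬ (p < z × z < q))

record FiniteGradedPoset : Set₁ where
  infix 4 _≤_
  field
    Elt               : Set
    _≤_               : Rel Elt Level.0ℓ
    isDecPartialOrder : IsDecPartialOrder _≡_ _≤_
    elements          : List Elt
    complete          : ∀ p → p ∈ elements
    unique            : Unique elements
    rank              : Elt → ℕ

  open Covering _≤_ public

  field
    rank-⋖ : ∀ {p q} → p ⋖ q → rank q ≡ suc (rank p)

  open IsDecPartialOrder isDecPartialOrder public using (_≟_; _≤?_)

  infix 4 _<?_ _⋖?_

  _<?_ : Decidable _<_
  _<?_ = ToStrict.<-decidable _≡_ _≤_ _≟_ _≤?_

  _⋖?_ : Decidable _⋖_
  p ⋖? q = (p <? q) ×-dec
    map′ (λ none z → All.lookup none (complete z)) (λ none → All.tabulate (λ {z} _ → none z))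
         (All.all? (λ z → ¬? ((p <? z) ×-dec (z <? q))) elements)

  maxRank : ℕ
  maxRank = foldr _⊔_ 0 (map rank elements)

------------------------------------------------------------------------
-- The poset M(n,k₁,…,kₙ)

-- Tuples are nested to the left: (((tt , x₁) , x₂) , …) , xₙ  with  xᵢ ∈ {0,…,kᵢ}.
Box : (n : ℕ) → Vector ℕ n → Set
Box zero    k = ⊤
Box (suc n) k = Box n (init k) × Fin (suc (last k))

module _ where
  private variable
    n : ℕ
    k : Vector ℕ n

  ∣_∣ᴮ : Box n k → ℕ
  ∣_∣ᴮ {zero}  _       = 0
  ∣_∣ᴮ {suc n} (a , j) = ∣ a ∣ᴮ ℕ.+ toℕ j

  infix 4 _≤ᴮ_

  _≤ᴮ_ : Rel (Box n k) Level.0ℓ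
  _≤ᴮ_ {zero}  _       _       = ⊤
  _≤ᴮ_ {suc n} (a , i) (b , j) = a ≤ᴮ b × i Fin.≤ j

  ≤ᴮ-refl : (a : Box n k) → a ≤ᴮ a
  ≤ᴮ-refl {zero}  _       = tt
  ≤ᴮ-refl {suc n} (a , i) = ≤ᴮ-refl a , ℕ.≤-refl

  ≤ᴮ-reflexive : {a b : Box n k} → a ≡ b → a ≤ᴮ b
  ≤ᴮ-reflexive {a = a} refl = ≤ᴮ-refl a

  ≤ᴮ-trans : {a b d : Box n k} → a ≤ᴮ b → b ≤ᴮ d → a ≤ᴮ d
  ≤ᴮ-trans {zero}  _       _         = tt
  ≤ᴮ-trans {suc n} (p , q) (p′ , q′) = ≤ᴮ-trans p p′ , ℕ.≤-trans q q′

  ≤ᴮ-antisym : {a b : Box n k} → a ≤ᴮ b → b ≤ᴮ a → a ≡ b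
  ≤ᴮ-antisym {zero}  _       _         = refl
  ≤ᴮ-antisym {suc n} (p , q) (p′ , q′) = cong₂ _,_ (≤ᴮ-antisym p p′) (Fin.≤-antisym q q′)

  ≡ᴮ-dec : Decidable {A = Box n k} _≡_
  ≡ᴮ-dec {zero}  _ _ = yes refl
  ≡ᴮ-dec {suc n}     = ≡-dec ≡ᴮ-dec Fin._≟_

  ≤ᴮ-dec : Decidable (_≤ᴮ_ {n} {k})
  ≤ᴮ-dec {zero}  _       _       = yes tt
  ≤ᴮ-dec {suc n} (a , i) (b , j) = ≤ᴮ-dec a b ×-dec (i Fin.≤? j)

boxElements : (n : ℕ) (k : Vector ℕ n) → List (Box n k)
boxElements zero    k = tt ∷ []
boxElements (suc n) k = cartesianProduct (boxElements n (init k)) (allFin (suc (last k)))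

boxComplete : (n : ℕ) (k : Vector ℕ n) (a : Box n k) → a ∈ boxElements n k
boxComplete zero    k tt      = here refl
boxComplete (suc n) k (a , j) = ∈-cartesianProduct⁺ (boxComplete n (init k) a) (∈-allFin j)

boxUnique : (n : ℕ) (k : Vector ℕ n) → Unique (boxElements n k)
boxUnique zero    k = All.[] ∷ []
boxUnique (suc n) k = cartesianProduct⁺ (boxUnique n (init k)) (allFin⁺ _)

boxRank-⋖ : (n : ℕ) (k : Vector ℕ n) {a b : Box n k} →
            Covering._⋖_ _≤ᴮ_ a b → ∣ b ∣ᴮ ≡ suc ∣ a ∣ᴮ
boxRank-⋖ zero    k ((_ , a≢b) , _) = ⊥-elim (a≢b refl)
boxRank-⋖ (suc n) k {a , i} {b , j} (((a≤b , i≤j) , ai≢bj) , none) with ≡ᴮ-dec a b | i Fin.≟ j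
... | yes refl | yes refl = ⊥-elim (ai≢bj refl)
... | no a≢b | no i≢j = ⊥-elim (none (a , j)
        ( ((≤ᴮ-refl a , i≤j) , i≢j ∘ cong proj₂)
        , ((a≤b , ℕ.≤-refl) , a≢b ∘ cong proj₁)))
... | no a≢b | yes refl = cong (ℕ._+ toℕ i) (boxRank-⋖ n (init k)
        ( (a≤b , a≢b)
        , λ { z ((a≤z , a≢z) , (z≤b , z≢b)) → none (z , i)
            ( ((a≤z , ℕ.≤-refl) , a≢z ∘ cong proj₁)
            , ((z≤b , ℕ.≤-refl) , z≢b ∘ cong proj₁)) }))
... | yes refl | no i≢j = trans (cong (∣ a ∣ᴮ ℕ.+_) j≡1+i) (ℕ.+-suc ∣ a ∣ᴮ (toℕ i))
  where
  i<j : toℕ i ℕ.< toℕ j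
  i<j = Fin.≤∧≢⇒< i≤j i≢j

  j≡1+i : toℕ j ≡ suc (toℕ i)
  j≡1+i with ℕ.m≤n⇒m<n∨m≡n i<j
  ... | inj₂ 1+i≡j = sym 1+i≡j
  ... | inj₁ 1+i<j = ⊥-elim (none (a , m)
          ( ((≤ᴮ-refl a , ℕ.≤-trans (ℕ.n≤1+n _) (ℕ.≤-reflexive (sym m≡))) , λ eq →
               ℕ.1+n≢n (trans (sym m≡) (sym (cong (toℕ ∘ proj₂) eq))))
          , ((≤ᴮ-refl a , ℕ.≤-trans (ℕ.≤-reflexive m≡) i<j) , λ eq →
               ℕ.<⇒≢ 1+i<j (trans (sym m≡) (cong (toℕ ∘ proj₂) eq)))))
    where
    1+i<n : suc (toℕ i) ℕ.< suc (last k)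
    1+i<n = ℕ.<-trans 1+i<j (Fin.toℕ<n j)

    m : Fin (suc (last k))
    m = Fin.fromℕ< 1+i<n

    m≡ : toℕ m ≡ suc (toℕ i)
    m≡ = Fin.toℕ-fromℕ< 1+i<n

M : (n : ℕ) → Vector ℕ n → FiniteGradedPoset
M n k = record
  { Elt               = Box n k
  ; _≤_               = _≤ᴮ_
  ; isDecPartialOrder = record
    { isPartialOrder = record
      { isPreorder = record
        { isEquivalence = isEquivalence
        ; reflexive     = ≤ᴮ-reflexive
        ; trans         = ≤ᴮ-trans
        }
      ; antisym = ≤ᴮ-antisym
      }
    ; _≟_  = ≡ᴮ-dec
    ; _≤?_ = ≤ᴮ-dec
    }
  ; elements = boxElements n k
  ; complete = boxComplete n k
  ; unique   = boxUnique n k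
  ; rank     = ∣_∣ᴮ
  ; rank-⋖   = boxRank-⋖ n k
  }

M₂ : ℕ → ℕ → FiniteGradedPoset
M₂ p q = M 2 (p Vector.∷ q Vector.∷ Vector.[])

pattern ⟨_,_⟩ i j = (tt , i) , j

------------------------------------------------------------------------
-- The nonempty sequences (v₀,…,vₗ)

Seq : ∀ {a} → Set a → Set a
Seq A = ∃ λ l → Vector A (suc l)

mapSeq : ∀ {a b} {A : Set a} {B : Set b} → (A → B) → Seq A → Seq B
mapSeq f (l , v) = l , f ∘ v

terms : ∀ {a} {A : Set a} → Seq A → List A
terms (_ , v) = Vector.toList v

------------------------------------------------------------------------
-- The vector space V(P), Jordan bases and the linear BTK algorithm, with
-- scalars in R.

module BTK {c ℓ} (R : CommutativeRing c ℓ) where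

  open CommutativeRing R hiding (refl; sym; trans; isEquivalence)
  open import Algebra.Properties.CommutativeMonoid.Sum +-commutativeMonoid using (sum)
  open import Algebra.Properties.Monoid.Mult +-monoid using () renaming (_×_ to _·_)
  open FiniteGradedPoset hiding (_≤_)

  fromℕᴿ : ℕ → Carrier
  fromℕᴿ m = m · 1#

  fromℤᴿ : ℤ → Carrier
  fromℤᴿ (+ m)    = fromℕᴿ m
  fromℤᴿ -[1+ m ] = - fromℕᴿ (suc m)

  sumOver : ∀ {a} {A : Set a} → List A → (A → Carrier) → Carrier
  sumOver xs f = sum (f ∘ lookup xs)

  -- A vector is given by its coefficients in the standard basis.
  V : FiniteGradedPoset → Set c
  V P = Elt P → Carrier

  module _ (P : FiniteGradedPoset) where

    infix 4 _≋_

    _≋_ : Rel (V P) ℓ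
    v ≋ w = ∀ p → v p ≈ w p

    0ⱽ : V P
    0ⱽ _ = 0#

    δ : Elt P → V P
    δ p q = if does (_≟_ P p q) then 1# else 0#

    -- The linear map V(P) → V(Q) that sends each basis element p to f p.
    extend : (Q : FiniteGradedPoset) → (Elt P → V Q) → V P → V Q
    extend Q f v q = sumOver (elements P) (λ p → v p * f p q)

  module _ (P : FiniteGradedPoset) where

    U : V P → V P
    U = extend P P λ p q → sumOver (filter (_⋖?_ P p) (elements P)) (λ q′ → δ P q′ q)

    HasRank : V P → ℕ → Set ℓ
    HasRank v i = ∀ p → rank P p ≢ i → v p ≈ 0#

    record IsGradedJordanChain (s : Seq (V P)) : Set ℓ where
      private
        l = proj₁ s
        v = proj₂ s
      field
        nonzero     : ∀ i → ¬ (_≋_ P (v i) (0ⱽ P))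
        homogeneous : ∀ i → ∃ (HasRank (v i))
        step        : ∀ (i : Fin l) → _≋_ P (U (v (inject₁ i))) (v (Fin.suc i))
        end         : _≋_ P (U (v (fromℕ l))) (0ⱽ P)

    record IsSymmetricJordanChain (s : Seq (V P)) : Set ℓ where
      field
        isGradedJordanChain : IsGradedJordanChain s
      open IsGradedJordanChain isGradedJordanChain public
      field
        symmetric : proj₁ (homogeneous Fin.zero) ℕ.+ proj₁ (homogeneous (fromℕ (proj₁ s)))
                    ≡ maxRank P

    combination : (bs : List (V P)) → Vector Carrier (length bs) → V P
    combination bs x p = sum (λ i → x i * lookup bs i p)

    record IsBasis (bs : List (V P)) : Set (c Level.⊔ ℓ) where
      field
        independent : ∀ x → _≋_ P (combination bs x) (0ⱽ P) → ∀ i → x i ≈ 0#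
        spanning    : ∀ v → ∃ λ x → _≋_ P (combination bs x) v

    -- The vectors of all the sequences are listed with repetition, so
    -- their independence makes the union of the chains disjoint.
    record IsSymmetricJordanBasis (𝓢 : List (Seq (V P))) : Set (c Level.⊔ ℓ) where
      field
        chains : All IsSymmetricJordanChain 𝓢
        basis  : IsBasis (concatMap terms 𝓢)

    IsIntegral : V P → Set ℓ
    IsIntegral v = ∀ p → ∃ λ (z : ℤ) → v p ≈ fromℤᴿ z

  -- Vectors of V(M(2,p,q)) for p, q ≥ 1, with p and q replaced by
  -- suc p and suc q.
  module _ (p q : ℕ) where

    binomialVector : ℕ → V (M₂ (suc p) (suc q))
    binomialVector k ⟨ i , j ⟩ =
      if does (toℕ i ℕ.+ toℕ j ℕ.≟ k) then fromℕᴿ (k C toℕ i) else 0#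

    -- The image of (i , j) is the vector v(i,j′) with j′ = suc j.
    θ : V (M₂ p q) → V (M₂ (suc p) (suc q))
    θ = extend (M₂ p q) (M₂ (suc p) (suc q)) λ where
      ⟨ i , j ⟩ x →
          fromℕᴿ (suc p ∸ toℕ i)               * δ (M₂ (suc p) (suc q)) ⟨ inject₁ i , Fin.suc j ⟩ x
        - fromℕᴿ (suc q ∸ suc (toℕ j) ℕ.+ 1) * δ (M₂ (suc p) (suc q)) ⟨ Fin.suc i , inject₁ j ⟩ x

  𝓙 : (p q : ℕ) → List (Seq (V (M₂ p q)))
  𝓙 zero    q       = (q , λ j → δ (M₂ 0 q) ⟨ Fin.zero , j ⟩) ∷ []
  𝓙 (suc p) zero    = (suc p , λ i → δ (M₂ (suc p) 0) ⟨ i , Fin.zero ⟩) ∷ []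
  𝓙 (suc p) (suc q) = (suc p ℕ.+ suc q , λ k → binomialVector p q (toℕ k))
                    ∷ map (mapSeq (θ p q)) (𝓙 p q)

  module _ (n : ℕ) (k : Vector ℕ (suc n)) where

    -- The linear map (a₁,…,aₙ) ↦ (a₁,…,aₙ,j).
    append : Fin (suc (last k)) → V (M n (init k)) → V (M (suc n) k)
    append j = extend (M n (init k)) (M (suc n) k) λ a → δ (M (suc n) k) (a , j)

    ψ : ((l , _) : Seq (V (M n (init k)))) → V (M₂ l (last k)) → V (M (suc n) k)
    ψ (l , v) = extend (M₂ l (last k)) (M (suc n) k) λ where
      ⟨ i , j ⟩ → append j (v i)

  -- 𝓛 n k is the collection for the n + 1 numbers k₁,…,kₙ₊₁.
  𝓛 : (n : ℕ) (k : Vector ℕ (suc n)) → List (Seq (V (M (suc n) k)))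
  𝓛 zero    k = (last k , λ i → δ (M 1 k) (tt , i)) ∷ []
  𝓛 (suc n) k =
    concatMap (λ s → map (mapSeq (ψ (suc n) k s)) (𝓙 (proj₁ s) (last k))) (𝓛 n (init k))

------------------------------------------------------------------------
-- The scalars: the library has no complex numbers, so ℂ is replaced by an
-- arbitrary Heyting field of characteristic zero.

module _ {c ℓ₁ ℓ₂} (K : HeytingField c ℓ₁ ℓ₂) where

  open HeytingField K using (_#_; 0#; heytingCommutativeRing)

  scalars : CommutativeRing c ℓ₁
  scalars = HeytingCommutativeRing.commutativeRing heytingCommutativeRing

  -- Apartness from 0 is the constructive form of being different from 0.
  CharacteristicZero : Set ℓ₂
  CharacteristicZero = ∀ m → BTK.fromℕᴿ scalars (suc m) # 0#

{-# OPTIONS --safe #-}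
module Submission where

-- For p, q ≥ 1, V(M(2,p,q)) is the direct sum of the span of the binomial
-- chain and the image of the injective map θ, which commutes with U.  The
-- functional of rank r that gives (i,j), i + j = r, the weight
-- p(p-1)⋯(p-i+1) · q(q-1)⋯(q-j+1) vanishes on the image of θ but not on the
-- binomial vector; hence independence.  Conversely θ w = u can be solved
-- recursively in i at the positions with i < p and j > 0; each rank contains
-- just one other position, and there the equation follows from the functional.
--
-- In general, ψ commutes with U because it is built from a Jordan chain, and
-- the slice of ψ(w) at last coordinate j is the combination of that chain with
-- coefficients w(-,j).  So the coordinates of the slices of a vector with
-- respect to 𝓛(k₁,…,kₙ₋₁) form vectors of V(M(2,l,kₙ)), which expand uniquely in
-- 𝓙(l,kₙ).  That no vector in a chain vanishes follows from independence.
open import Defs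
open import Algebra.Apartness.Bundles using (HeytingField)
open import Algebra.Bundles using (CommutativeRing)
open import Data.Bool using (true; false; if_then_else_)
open import Data.Empty using (⊥-elim)
open import Data.Fin as Fin using (Fin; toℕ; fromℕ; inject₁)
import Data.Fin.Properties as Fin
open import Data.Fin.Relation.Unary.Top as Top using (view; ‵fromℕ; ‵inject₁)
open import Data.Integer as ℤ using (+_; -[1+_])
import Data.Integer.Properties as ℤ
open import Data.List
  using (List; []; _∷_; _++_; map; concatMap; filter; foldr; cartesianProduct; allFin; tabulate; length; lookup)
open import Data.List.Membership.Propositional using (_∈_)
open import Data.List.Membership.Propositional.Properties using (∈-allFin)
open import Data.List.Relation.Unary.All as All using (All; []; _∷_)
import Data.List.Relation.Unary.All.Properties as All
open import Data.List.Relation.Unary.AllPairs using ([]; _∷_)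
open import Data.List.Relation.Unary.Any using (here; there)
open import Data.List.Relation.Unary.Unique.Propositional using (Unique)
open import Data.List.Relation.Unary.Unique.Propositional.Properties using (allFin⁺)
open import Data.Nat as ℕ using (ℕ; zero; suc; _∸_; _⊔_)
open import Data.Nat.Combinatorics using (_C_; nCn≡1; nCk+nC[k+1]≡[n+1]C[k+1])
open import Data.Nat.Combinatorics.Base using (_P′_)
open import Data.Nat.ListAction using () renaming (sum to sumℕ)
import Data.Nat.Properties as ℕ
import Data.Nat.Tactic.RingSolver as ℕ
open import Data.Product using (∃; _×_; _,_; proj₁; proj₂)
open import Data.Sum using (_⊎_; inj₁; inj₂; [_,_]′)
open import Data.Unit using (tt)
import Data.Unit.Polymorphic as Unit
open import Data.Vec.Functional as Vector using (Vector; init; last)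
open import Function using (_∘_; id)
open import Level using (Level)
open import Relation.Binary.PropositionalEquality as ≡ using (_≡_; _≢_; cong; cong₂; subst)
open import Relation.Nullary using (¬_; Dec; yes; no; does)
open import Relation.Nullary.Decidable using (_×-dec_)
open import Relation.Unary using (Pred)

-- The coefficients `p - i` and `q - j + 1` of `v(i,j)` do two jobs. Each drops by one when its
-- coordinate grows by one, so in comparing `U(v(i,j))` with `v(i+1,j) + v(i,j+1)` the discrepancies
-- at `(i+1,j)` cancel; this is why θ commutes with `U`. And their quotient `(p - i)/(q - j + 1)` is
-- the weight of `(i+1,j-1)` divided by that of `(i,j)`, so the functional kills every `v(i,j)`. On
-- a binomial vector the functional is a sum of positive integers, and here characteristic zero
-- enters. Spanning is not obtained by counting dimensions: all coefficients are written down
-- explicitly, with inverses `ι m` of the positive integers `m + 1`. The argument therefore runs in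
-- a commutative ring that has these inverses.

-- Covering relation and rank of `M n k`

module _ {n} {k : Vector ℕ (suc n)} {a b : Box n (init k)} {i j : Fin (suc (last k))} where

  open FiniteGradedPoset using (_⋖_; rank-⋖)

  -- If both parts changed, `(a , j)` would lie strictly between the two elements. If only the last
  -- coordinate changes, the rank function forces it to grow by exactly one.
  ⋖-split : _⋖_ (M (suc n) k) (a , i) (b , j) →
            (_⋖_ (M n (init k)) a b × i ≡ j) ⊎ (a ≡ b × toℕ j ≡ suc (toℕ i))
  ⋖-split c@(((a≤b , i≤j) , ai≢bj) , none) with ≡ᴮ-dec a b | i Fin.≟ j
  ... | yes ≡.refl | _ = inj₂ (≡.refl , ℕ.+-cancelˡ-≡ ∣ a ∣ᴮ _ _
          (≡.trans (rank-⋖ (M (suc n) k) c) (≡.sym (ℕ.+-suc ∣ a ∣ᴮ (toℕ i)))))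
  ... | no a≢b | no i≢j = ⊥-elim (none (a , j)
          ( ((≤ᴮ-refl a , i≤j) , i≢j ∘ cong proj₂)
          , ((a≤b , ℕ.≤-refl) , a≢b ∘ cong proj₁)))
  ... | no a≢b | yes ≡.refl = inj₁
          ( ( (a≤b , a≢b)
            , λ { z ((a≤z , a≢z) , (z≤b , z≢b)) → none (z , i)
                ( ((a≤z , ℕ.≤-refl) , a≢z ∘ cong proj₁)
                , ((z≤b , ℕ.≤-refl) , z≢b ∘ cong proj₁)) })
          , ≡.refl)

  ⋖-fst : _⋖_ (M n (init k)) a b → i ≡ j → _⋖_ (M (suc n) k) (a , i) (b , j)
  ⋖-fst ((a≤b , a≢b) , none) ≡.refl =
      ((a≤b , ℕ.≤-refl) , a≢b ∘ cong proj₁)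
    , λ { (z , m) (((a≤z , i≤m) , ai≢zm) , ((z≤b , m≤i) , zm≢bi)) →
          let m≡i = Fin.≤-antisym m≤i i≤m in
          none z ( (a≤z , λ a≡z → ai≢zm (cong₂ _,_ a≡z (≡.sym m≡i)))
                 , (z≤b , λ z≡b → zm≢bi (cong₂ _,_ z≡b m≡i))) }

  ⋖-snd : a ≡ b → toℕ j ≡ suc (toℕ i) → _⋖_ (M (suc n) k) (a , i) (b , j)
  ⋖-snd ≡.refl j≡1+i =
      ((≤ᴮ-refl a , ℕ.≤-trans (ℕ.n≤1+n _) (ℕ.≤-reflexive (≡.sym j≡1+i)))
      , λ eq → ℕ.1+n≢n (≡.trans (≡.sym j≡1+i) (≡.sym (cong (toℕ ∘ proj₂) eq))))
    , λ { (z , m) (((a≤z , i≤m) , ai≢zm) , ((z≤a , m≤j) , zm≢aj)) →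
          let a≡z = ≤ᴮ-antisym a≤z z≤a
              i<m = Fin.≤∧≢⇒< i≤m (λ i≡m → ai≢zm (cong₂ _,_ a≡z i≡m))
              m<j = Fin.≤∧≢⇒< m≤j (λ m≡j → zm≢aj (cong₂ _,_ (≡.sym a≡z) m≡j))
          in ℕ.<-irrefl (≡.sym j≡1+i) (ℕ.≤-<-trans i<m m<j) }

total : (n : ℕ) → Vector ℕ n → ℕ
total zero    k = 0
total (suc n) k = total n (init k) ℕ.+ last k

box-rank≤total : ∀ n k (a : Box n k) → ∣ a ∣ᴮ ℕ.≤ total n k
box-rank≤total zero    k _       = ℕ.z≤n
box-rank≤total (suc n) k (a , j) =
  ℕ.+-mono-≤ (box-rank≤total n (init k) a) (ℕ.≤-pred (Fin.toℕ<n j))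

top : ∀ n k → Box n k
top zero    k = tt
top (suc n) k = top n (init k) , fromℕ (last k)

rank-top : ∀ n k → ∣ top n k ∣ᴮ ≡ total n k
rank-top zero    k = ≡.refl
rank-top (suc n) k = cong₂ ℕ._+_ (rank-top n (init k)) (Fin.toℕ-fromℕ (last k))

module _ {A : Set} (f : A → ℕ) where

  maximum-upper : ∀ {x xs} → x ∈ xs → f x ℕ.≤ foldr _⊔_ 0 (map f xs)
  maximum-upper (here ≡.refl)          = ℕ.m≤m⊔n _ _
  maximum-upper {xs = y ∷ _} (there x∈) = ℕ.≤-trans (maximum-upper x∈) (ℕ.m≤n⊔m (f y) _)

  maximum-least : ∀ {d} → (∀ x → f x ℕ.≤ d) → ∀ xs → foldr _⊔_ 0 (map f xs) ℕ.≤ d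
  maximum-least f≤d []       = ℕ.z≤n
  maximum-least f≤d (x ∷ xs) = ℕ.⊔-lub (f≤d x) (maximum-least f≤d xs)

-- Symmetry of a chain refers to `maxRank`; the recursive `total` is what the inductions on `n` can
-- work with.
maxRank-M : ∀ n k → FiniteGradedPoset.maxRank (M n k) ≡ total n k
maxRank-M n k = ℕ.≤-antisym (maximum-least ∣_∣ᴮ (box-rank≤total n k) (boxElements n k))
  (ℕ.≤-trans (ℕ.≤-reflexive (≡.sym (rank-top n k))) (maximum-upper ∣_∣ᴮ (boxComplete n k (top n k))))

-- Positivity of the combinatorial numbers, and corners of a rectangle

nCk>0 : ∀ {n k} → k ℕ.≤ n → 0 ℕ.< n C k
nCk>0 {n}     {zero}  _           = ℕ.≤-refl
nCk>0 {suc n} {suc k} (ℕ.s≤s k≤n) = ℕ.≤-trans (nCk>0 k≤n)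
  (ℕ.≤-trans (ℕ.m≤m+n (n C k) (n C suc k)) (ℕ.≤-reflexive (nCk+nC[k+1]≡[n+1]C[k+1] n k)))

nP′k>0 : ∀ {n k} → k ℕ.≤ n → 0 ℕ.< n P′ k
nP′k>0 {n} {zero}  _   = ℕ.≤-refl
nP′k>0 {n} {suc k} k<n = ℕ.*-mono-≤ (ℕ.m<n⇒0<n∸m k<n) (nP′k>0 (ℕ.<⇒≤ k<n))

sum-positive : ∀ {A : Set} (h : A → ℕ) {x xs} → x ∈ xs → 0 ℕ.< h x → 0 ℕ.< sumℕ (map h xs)
sum-positive h {x} (here ≡.refl)           hx>0 = ℕ.≤-trans hx>0 (ℕ.m≤m+n (h x) _)
sum-positive h {xs = y ∷ _} (there x∈) hx>0 = ℕ.≤-trans (sum-positive h x∈ hx>0) (ℕ.m≤n+m _ (h y))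

-- The corners form a path along the edge `j = 0` and then along the edge `i = P`, and the rank
-- increases strictly on it.
corner-unique : ∀ {P i j i′ j′} → i ℕ.≤ P → i′ ℕ.≤ P → i ℕ.+ j ≡ i′ ℕ.+ j′ →
                j ≡ 0 ⊎ i ≡ P → j′ ≡ 0 ⊎ i′ ≡ P → i ≡ i′ × j ≡ j′
corner-unique {P} {i} {j} {i′} {j′} i≤P i′≤P eq c c′ =
  i≡i′ c c′ , ℕ.+-cancelˡ-≡ i j j′ (≡.trans eq (cong (ℕ._+ j′) (≡.sym (i≡i′ c c′))))
  where
  i≡i′ : j ≡ 0 ⊎ i ≡ P → j′ ≡ 0 ⊎ i′ ≡ P → i ≡ i′
  i≡i′ (inj₁ ≡.refl) (inj₁ ≡.refl) = ℕ.+-cancelʳ-≡ 0 i i′ eq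
  i≡i′ (inj₁ ≡.refl) (inj₂ ≡.refl) = ℕ.≤-antisym i≤P
    (ℕ.≤-trans (ℕ.m≤m+n i′ j′) (ℕ.≤-reflexive (≡.trans (≡.sym eq) (ℕ.+-identityʳ i))))
  i≡i′ (inj₂ ≡.refl) (inj₁ ≡.refl) = ℕ.≤-antisym
    (ℕ.≤-trans (ℕ.m≤m+n i j) (ℕ.≤-reflexive (≡.trans eq (ℕ.+-identityʳ i′)))) i′≤P
  i≡i′ (inj₂ ≡.refl) (inj₂ ≡.refl) = ≡.refl

module LinearBTK {c ℓ} (R : CommutativeRing c ℓ) where

  open CommutativeRing R hiding (zero)
  open BTK R
  open FiniteGradedPoset hiding (_≤_)
  open import Algebra.Properties.CommutativeMonoid.Sum +-commutativeMonoid
    using (sum; sum-cong-≋; sum-replicate-zero; ∑-distrib-+; sum-init-last)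
    renaming (∑-comm to sum-comm)
  open import Algebra.Properties.Ring ring
    using (-‿distribˡ-*; -‿distribʳ-*; -0#≈0#; -1*x≈-x; -‿+-comm; -‿involutive)
  open import Algebra.Properties.Semiring.Mult semiring using (×-homo-+; ×1-homo-*)
  open import Algebra.Properties.Semiring.Sum semiring using (*-distribˡ-sum; *-distribʳ-sum)
  open import Relation.Binary.Reasoning.Setoid setoid

  private variable
    ℓ₁ ℓ₂ : Level
    A : Set ℓ₁
    B : Set ℓ₂

  -- Finite sums

  sum-zero : ∀ {n} {f : Vector Carrier n} → (∀ i → f i ≈ 0#) → sum f ≈ 0#
  sum-zero {n} f≈0 = trans (sum-cong-≋ f≈0) (sum-replicate-zero n)

  -- Opaque, because unification cannot recover f from f ∘ lookup xs.
  opaque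
    ∑ : List A → (A → Carrier) → Carrier
    ∑ = sumOver

    sumOver≈∑ : ∀ (xs : List A) f → sumOver xs f ≈ ∑ xs f
    sumOver≈∑ xs f = refl

    ∑-cong : ∀ xs {f g : A → Carrier} → (∀ x → f x ≈ g x) → ∑ xs f ≈ ∑ xs g
    ∑-cong xs f≈g = sum-cong-≋ (f≈g ∘ lookup xs)

    ∑-zero : ∀ xs {f : A → Carrier} → (∀ x → f x ≈ 0#) → ∑ xs f ≈ 0#
    ∑-zero xs f≈0 = sum-zero (f≈0 ∘ lookup xs)

    ∑-+ : ∀ xs (f g : A → Carrier) → ∑ xs (λ x → f x + g x) ≈ ∑ xs f + ∑ xs g
    ∑-+ xs f g = ∑-distrib-+ (f ∘ lookup xs) (g ∘ lookup xs)

    *-distribˡ-∑ : ∀ xs y (f : A → Carrier) → y * ∑ xs f ≈ ∑ xs (λ x → y * f x)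
    *-distribˡ-∑ xs y f = *-distribˡ-sum y (f ∘ lookup xs)

    *-distribʳ-∑ : ∀ xs y (f : A → Carrier) → ∑ xs f * y ≈ ∑ xs (λ x → f x * y)
    *-distribʳ-∑ xs y f = *-distribʳ-sum y (f ∘ lookup xs)

    ∑-comm : ∀ xs ys (f : A → B → Carrier) →
      ∑ xs (λ x → ∑ ys (f x)) ≈ ∑ ys (λ y → ∑ xs (λ x → f x y))
    ∑-comm xs ys f = sum-comm (λ i j → f (lookup xs i) (lookup ys j))

    ∑-zero-All : ∀ {xs} {f : A → Carrier} → All (λ x → f x ≈ 0#) xs → ∑ xs f ≈ 0#
    ∑-zero-All []         = refl
    ∑-zero-All (px ∷ pxs) = trans (+-cong px (∑-zero-All pxs)) (+-identityˡ 0#)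

    ∑-single : ∀ {xs x} {f : A → Carrier} → Unique xs → x ∈ xs →
      (∀ y → y ≢ x → f y ≈ 0#) → ∑ xs f ≈ f x
    ∑-single (x∉ ∷ _) (here ≡.refl) f≈0 = trans
      (+-congˡ (∑-zero-All (All.map (λ x≢y → f≈0 _ (x≢y ∘ ≡.sym)) x∉))) (+-identityʳ _)
    ∑-single (y∉ ∷ u) (there x∈) f≈0 = trans
      (+-cong (f≈0 _ (All.lookup y∉ x∈)) (∑-single u x∈ f≈0)) (+-identityˡ _)

    ∑-++ : ∀ xs ys (f : A → Carrier) → ∑ (xs ++ ys) f ≈ ∑ xs f + ∑ ys f
    ∑-++ []       ys f = sym (+-identityˡ _)
    ∑-++ (x ∷ xs) ys f = trans (+-congˡ (∑-++ xs ys f)) (sym (+-assoc _ _ _))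

    ∑-map : ∀ (g : B → A) xs (f : A → Carrier) →
      ∑ (map g xs) f ≈ ∑ xs (f ∘ g)
    ∑-map g []       f = refl
    ∑-map g (x ∷ xs) f = +-congˡ (∑-map g xs f)

    ∑-tabulate : ∀ {n} (g : Fin n → A) (f : A → Carrier) →
      ∑ (tabulate g) f ≈ sum (f ∘ g)
    ∑-tabulate {n = zero}  g f = refl
    ∑-tabulate {n = suc n} g f = +-congˡ (∑-tabulate (g ∘ Fin.suc) f)

    ∑-filter : ∀ {p} {P : Pred A p} (P? : ∀ x → Dec (P x)) xs (f : A → Carrier) →
      ∑ (filter P? xs) f ≈ ∑ xs (λ x → if does (P? x) then f x else 0#)
    ∑-filter P? []       f = refl
    ∑-filter P? (x ∷ xs) f with does (P? x)
    ... | true  = +-congˡ (∑-filter P? xs f)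
    ... | false = trans (∑-filter P? xs f) (sym (+-identityˡ _))

    ∑-cartesianProduct : ∀ xs ys (f : A × B → Carrier) →
      ∑ (cartesianProduct xs ys) f ≈ ∑ xs (λ x → ∑ ys (λ y → f (x , y)))
    ∑-cartesianProduct []       ys f = refl
    ∑-cartesianProduct (x ∷ xs) ys f = trans (∑-++ (map (x ,_) ys) _ f)
      (+-cong (∑-map (x ,_) ys f) (∑-cartesianProduct xs ys f))

  -- The up operator

  ind : Dec A → Carrier
  ind A? = if does A? then 1# else 0#

  ind-yes : (A? : Dec A) → A → ind A? ≈ 1#
  ind-yes (yes _) _ = refl
  ind-yes (no ¬a) a = ⊥-elim (¬a a)

  ind-no : (A? : Dec A) → ¬ A → ind A? ≈ 0#
  ind-no (yes a) ¬a = ⊥-elim (¬a a)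
  ind-no (no _)  _  = refl

  ind-× : ∀ (A? : Dec A) (B? : Dec B) →
          ind (A? ×-dec B?) ≈ ind A? * ind B?
  ind-× (yes _) B? = sym (*-identityˡ _)
  ind-× (no _)  B? = sym (zeroˡ _)

  *-zeroʳ : ∀ {x y} → y ≈ 0# → x * y ≈ 0#
  *-zeroʳ y≈0 = trans (*-congˡ y≈0) (zeroʳ _)

  *-zeroˡ : ∀ {x y} → x ≈ 0# → x * y ≈ 0#
  *-zeroˡ x≈0 = trans (*-congʳ x≈0) (zeroˡ _)

  *-oneʳ : ∀ {x y} → y ≈ 1# → x * y ≈ x
  *-oneʳ y≈1 = trans (*-congˡ y≈1) (*-identityʳ _)

  +-zero : ∀ {x y} → x ≈ 0# → y ≈ 0# → x + y ≈ 0#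
  +-zero x≈0 y≈0 = trans (+-cong x≈0 y≈0) (+-identityˡ 0#)

  module _ (P : FiniteGradedPoset) where

    ∑-elements-single : ∀ {f} p → (∀ q → q ≢ p → f q ≈ 0#) → ∑ (elements P) f ≈ f p
    ∑-elements-single p = ∑-single (unique P) (complete P p)

    -- Every element is listed exactly once, so the inner sum of the `δ P q′ q` over the covers `q′`
    -- of `p` collapses to the indicator of `p ⋖ q`.
    U-formula : ∀ v q → U P v q ≈ ∑ (elements P) (λ p → v p * ind (_⋖?_ P p q))
    U-formula v q = trans (sumOver≈∑ (elements P) _) (∑-cong (elements P) λ p → *-congˡ (trans
      (trans (sumOver≈∑ _ _) (∑-filter (_⋖?_ P p) (elements P) _))
      (trans (∑-elements-single q λ r r≢q → if-zero (does (_⋖?_ P p r)) (ind-no (_≟_ P r q) r≢q))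
             (if-one (does (_⋖?_ P p q)) (ind-yes (_≟_ P q q) ≡.refl)))))
      where
      if-zero : ∀ b {x} → x ≈ 0# → (if b then x else 0#) ≈ 0#
      if-zero true  x≈0 = x≈0
      if-zero false _   = refl

      if-one : ∀ b {x} → x ≈ 1# → (if b then x else 0#) ≈ (if b then 1# else 0#)
      if-one true  x≈1 = x≈1
      if-one false _   = refl

  -- The up operator of a chain in coordinates: every coefficient moves up by one place and the top
  -- one is lost.
  below : ∀ {m} → Vector Carrier (suc m) → Vector Carrier (suc m)
  below f Fin.zero    = 0#
  below f (Fin.suc j) = f (inject₁ j)

  module _ n (k : Vector ℕ (suc n)) where

    -- The two ways to cover in a product exclude each other, so the indicator of the disjunction is
    -- a sum.
    ind-⋖ : ∀ a i b j → ind (_⋖?_ (M (suc n) k) (a , i) (b , j)) ≈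
            ind (_⋖?_ (M n (init k)) a b) * ind (i Fin.≟ j)
            + ind (_≟_ (M n (init k)) a b) * ind (toℕ j ℕ.≟ suc (toℕ i))
    ind-⋖ a i b j = trans (go (_⋖?_ (M n (init k)) a b ×-dec i Fin.≟ j)
                              (_≟_ (M n (init k)) a b ×-dec toℕ j ℕ.≟ suc (toℕ i)))
      (+-cong (ind-× (_⋖?_ (M n (init k)) a b) (i Fin.≟ j))
              (ind-× (_≟_ (M n (init k)) a b) (toℕ j ℕ.≟ suc (toℕ i))))
      where
      c? = _⋖?_ (M (suc n) k) (a , i) (b , j)

      go : (d : Dec (_⋖_ (M n (init k)) a b × i ≡ j))
           (e : Dec (a ≡ b × toℕ j ≡ suc (toℕ i))) → ind c? ≈ ind d + ind e
      go (yes (_ , ≡.refl)) (yes (_ , j≡1+i)) = ⊥-elim (ℕ.1+n≢n (≡.sym j≡1+i))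
      go (yes (a⋖b , i≡j)) (no _) = trans (ind-yes c? (⋖-fst {k = k} a⋖b i≡j)) (sym (+-identityʳ _))
      go (no _) (yes (a≡b , j≡1+i)) = trans (ind-yes c? (⋖-snd {k = k} a≡b j≡1+i)) (sym (+-identityˡ _))
      go (no ¬d) (no ¬e) = trans (ind-no c? λ c → [ ¬d , ¬e ]′ (⋖-split {k = k} c)) (sym (+-identityˡ _))

    -- The up operator of a product is a derivation, `U ⊗ 1 + 1 ⊗ U`: either the first part is
    -- raised with `j` fixed, or the last coordinate is.
    U-suc : ∀ v b j → U (M (suc n) k) v (b , j) ≈
            U (M n (init k)) (λ a → v (a , j)) b + below (λ i → v (b , i)) j
    U-suc v b j = begin
      U (M (suc n) k) v (b , j)
        ≈⟨ U-formula (M (suc n) k) v (b , j) ⟩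
      ∑ els (λ x → v x * ind (_⋖?_ (M (suc n) k) x (b , j)))
        ≈⟨ ∑-cong els (λ (a , i) → trans (*-congˡ (ind-⋖ a i b j)) (distribˡ _ _ _)) ⟩
      ∑ els (λ x → t₁ x + t₂ x)
        ≈⟨ ∑-+ els t₁ t₂ ⟩
      ∑ els t₁ + ∑ els t₂
        ≈⟨ +-cong first (second j) ⟩
      U (M n (init k)) (λ a → v (a , j)) b + below (λ i → v (b , i)) j ∎
      where
      els = elements (M (suc n) k)

      t₁ t₂ : Elt (M (suc n) k) → Carrier
      t₁ (a , i) = v (a , i) * (ind (_⋖?_ (M n (init k)) a b) * ind (i Fin.≟ j))
      t₂ (a , i) = v (a , i) * (ind (_≟_ (M n (init k)) a b) * ind (toℕ j ℕ.≟ suc (toℕ i)))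

      first : ∑ els t₁ ≈ U (M n (init k)) (λ a → v (a , j)) b
      first = begin
        ∑ els t₁
          ≈⟨ ∑-cartesianProduct (boxElements n (init k)) (allFin _) t₁ ⟩
        ∑ (boxElements n (init k)) (λ a → ∑ (allFin _) (λ i → t₁ (a , i)))
          ≈⟨ ∑-cong (boxElements n (init k)) (λ a → trans
               (∑-single (allFin⁺ _) (∈-allFin j) λ i i≢j →
                 *-zeroʳ (*-zeroʳ (ind-no (i Fin.≟ j) i≢j)))
               (*-congˡ (*-oneʳ (ind-yes (j Fin.≟ j) ≡.refl)))) ⟩
        ∑ (boxElements n (init k)) (λ a → v (a , j) * ind (_⋖?_ (M n (init k)) a b))
          ≈⟨ U-formula (M n (init k)) _ b ⟨
        U (M n (init k)) (λ a → v (a , j)) b ∎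

      second : ∀ j → ∑ els (λ (a , i) → v (a , i) *
                 (ind (_≟_ (M n (init k)) a b) * ind (toℕ j ℕ.≟ suc (toℕ i)))) ≈ below (λ i → v (b , i)) j
      second Fin.zero = ∑-zero els λ (a , i) → *-zeroʳ (zeroʳ _)
      second (Fin.suc j) = trans
        (∑-elements-single (M (suc n) k) (b , inject₁ j) λ (a , i) ai≢ →
          trans (*-congˡ (sym (ind-× (_≟_ (M n (init k)) a b) (suc (toℕ j) ℕ.≟ suc (toℕ i)))))
                (*-zeroʳ (ind-no (_≟_ (M n (init k)) a b ×-dec suc (toℕ j) ℕ.≟ suc (toℕ i))
                  λ (a≡b , j≡i) → ai≢ (cong₂ _,_ a≡b
                    (Fin.toℕ-injective (≡.trans (≡.sym (ℕ.suc-injective j≡i)) (≡.sym (Fin.toℕ-inject₁ j))))))))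
        (*-oneʳ (trans (*-oneʳ (ind-yes (suc (toℕ j) ℕ.≟ suc (toℕ (inject₁ j))) 
                                 (cong suc (≡.sym (Fin.toℕ-inject₁ j)))))
                       (ind-yes (_≟_ (M n (init k)) b b) ≡.refl)))

  extend-∑ : ∀ P Q f v q → extend P Q f v q ≈ ∑ (elements P) (λ p → v p * f p q)
  extend-∑ P Q f v q = sumOver≈∑ (elements P) _

  ∑-elements-suc : ∀ n (k : Vector ℕ (suc n)) f →
    ∑ (elements (M (suc n) k)) f ≈ ∑ (elements (M n (init k))) (λ a → sum (λ j → f (a , j)))
  ∑-elements-suc n k f = trans (∑-cartesianProduct (elements (M n (init k))) (allFin _) f)
    (∑-cong (elements (M n (init k))) (λ a → ∑-tabulate id (λ j → f (a , j))))

  ∑-elements-M₂ : ∀ p q f → ∑ (elements (M₂ p q)) f ≈ sum (λ i → sum (λ j → f ⟨ i , j ⟩))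
  ∑-elements-M₂ p q f = trans (∑-elements-suc 1 (p Vector.∷ q Vector.∷ Vector.[]) f)
    (trans (∑-elements-suc 0 (init (p Vector.∷ q Vector.∷ Vector.[])) (λ a → sum (λ j → f (a , j))))
           (∑-single (All.[] ∷ []) (here ≡.refl) (λ { tt tt≢tt → ⊥-elim (tt≢tt ≡.refl) })))

  -- Linear combinations of families of sequences

  chainSum : ((l , _) : Seq (A → Carrier)) → Vector Carrier (suc l) → A → Carrier
  chainSum (_ , v) x p = sum (λ i → x i * v i p)

  -- The coefficients of a linear combination, one vector for each sequence.
  Coef : List (Seq A) → Set c
  Coef []      = Unit.⊤
  Coef (s ∷ 𝓢) = Vector Carrier (suc (proj₁ s)) × Coef 𝓢

  Null : (𝓢 : List (Seq A)) → Coef 𝓢 → Set ℓ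
  Null []      _       = Unit.⊤
  Null (s ∷ 𝓢) (x , y) = (∀ i → x i ≈ 0#) × Null 𝓢 y

  lin : (𝓢 : List (Seq (A → Carrier))) → Coef 𝓢 → A → Carrier
  lin []      _       _ = 0#
  lin (s ∷ 𝓢) (x , y) p = chainSum s x p + lin 𝓢 y p

  -- Coefficients are grouped by sequence, as in the recursion of the algorithm, rather than indexed
  -- by one flat list. `Basis⇒IsBasis` translates back at the end.
  record Basis {A : Set ℓ₁} (𝓢 : List (Seq (A → Carrier))) : Set (ℓ₁ Level.⊔ c Level.⊔ ℓ) where
    field
      independent : ∀ x → (∀ p → lin 𝓢 x p ≈ 0#) → Null 𝓢 x
      spanning    : ∀ (v : A → Carrier) → ∃ λ x → ∀ p → lin 𝓢 x p ≈ v p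

  module _ {A : Set ℓ₁} where

    -- The length of `tabulate v ++ ws` does not reduce while `l` is a variable, so indices are
    -- split and joined by recursion on `l`.
    takeCoef : ∀ {l} (v : Vector A l) ws → Vector Carrier (length (tabulate v ++ ws)) → Vector Carrier l
    takeCoef v ws x Fin.zero    = x Fin.zero
    takeCoef v ws x (Fin.suc i) = takeCoef (Vector.tail v) ws (x ∘ Fin.suc) i

    dropCoef : ∀ {l} (v : Vector A l) ws → Vector Carrier (length (tabulate v ++ ws)) →
               Vector Carrier (length ws)
    dropCoef {zero}  v ws x = x
    dropCoef {suc l} v ws x = dropCoef (Vector.tail v) ws (x ∘ Fin.suc)

    joinCoef : ∀ {l} (v : Vector A l) ws → Vector Carrier l → Vector Carrier (length ws) →
               Vector Carrier (length (tabulate v ++ ws))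
    joinCoef {zero}  v ws x y             = y
    joinCoef {suc l} v ws x y Fin.zero    = x Fin.zero
    joinCoef {suc l} v ws x y (Fin.suc i) = joinCoef (Vector.tail v) ws (Vector.tail x) y i

    take∧drop-null : ∀ {l} (v : Vector A l) ws x → (∀ i → takeCoef v ws x i ≈ 0#) →
                     (∀ i → dropCoef v ws x i ≈ 0#) → ∀ i → x i ≈ 0#
    take∧drop-null {zero}  v ws x t d i           = d i
    take∧drop-null {suc l} v ws x t d Fin.zero    = t Fin.zero
    take∧drop-null {suc l} v ws x t d (Fin.suc i) =
      take∧drop-null (Vector.tail v) ws (x ∘ Fin.suc) (t ∘ Fin.suc) d i

    collect : (𝓢 : List (Seq A)) → Vector Carrier (length (concatMap terms 𝓢)) → Coef 𝓢
    collect []            x = _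
    collect ((l , v) ∷ 𝓢) x =
      takeCoef v (concatMap terms 𝓢) x , collect 𝓢 (dropCoef v (concatMap terms 𝓢) x)

    flatten : (𝓢 : List (Seq A)) → Coef 𝓢 → Vector Carrier (length (concatMap terms 𝓢))
    flatten []            _       ()
    flatten ((l , v) ∷ 𝓢) (x , y) = joinCoef v (concatMap terms 𝓢) x (flatten 𝓢 y)

    collect-null : ∀ 𝓢 x → Null 𝓢 (collect 𝓢 x) → ∀ i → x i ≈ 0#
    collect-null ((l , v) ∷ 𝓢) x (n , ns) = take∧drop-null v (concatMap terms 𝓢) x n
      (collect-null 𝓢 (dropCoef v (concatMap terms 𝓢) x) ns)

  module _ (P : FiniteGradedPoset) where

    combination-split : ∀ {l} (v : Vector (V P) l) ws x p →
      combination P (tabulate v ++ ws) x p ≈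
      sum (λ i → takeCoef v ws x i * v i p) + combination P ws (dropCoef v ws x) p
    combination-split {zero}  v ws x p = sym (+-identityˡ _)
    combination-split {suc l} v ws x p = trans
      (+-congˡ (combination-split (Vector.tail v) ws (x ∘ Fin.suc) p)) (sym (+-assoc _ _ _))

    combination-join : ∀ {l} (v : Vector (V P) l) ws x y p →
      combination P (tabulate v ++ ws) (joinCoef v ws x y) p ≈
      sum (λ i → x i * v i p) + combination P ws y p
    combination-join {zero}  v ws x y p = sym (+-identityˡ _)
    combination-join {suc l} v ws x y p = trans
      (+-congˡ (combination-join (Vector.tail v) ws (Vector.tail x) y p)) (sym (+-assoc _ _ _))

    lin-collect : ∀ 𝓢 x p → lin 𝓢 (collect 𝓢 x) p ≈ combination P (concatMap terms 𝓢) x p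
    lin-collect []            x p = refl
    lin-collect ((l , v) ∷ 𝓢) x p = trans
      (+-congˡ (lin-collect 𝓢 (dropCoef v (concatMap terms 𝓢) x) p))
      (sym (combination-split v (concatMap terms 𝓢) x p))

    combination-flatten : ∀ 𝓢 y p → combination P (concatMap terms 𝓢) (flatten 𝓢 y) p ≈ lin 𝓢 y p
    combination-flatten []            _       p = refl
    combination-flatten ((l , v) ∷ 𝓢) (x , y) p = trans
      (combination-join v (concatMap terms 𝓢) x (flatten 𝓢 y) p)
      (+-congˡ (combination-flatten 𝓢 y p))

    Basis⇒IsBasis : ∀ {𝓢} → Basis 𝓢 → IsBasis P (concatMap terms 𝓢)
    Basis⇒IsBasis {𝓢} b = record
      { independent = λ x x≋0 → collect-null 𝓢 x
          (independent (collect 𝓢 x) (λ p → trans (lin-collect 𝓢 x p) (x≋0 p)))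
      ; spanning = λ v → let x , x≋v = spanning v in
          flatten 𝓢 x , λ p → trans (combination-flatten 𝓢 x p) (x≋v p)
      }
      where open Basis b

  module _ {A : Set ℓ₁} {B : Set ℓ₂} (F : A → B) where

    -- `mapSeq` keeps lengths, so both types of coefficients hold the same data, but they agree only
    -- after recursion on the list.
    unmapCoef : (𝓢 : List (Seq A)) → Coef (map (mapSeq F) 𝓢) → Coef 𝓢
    unmapCoef []      _       = _
    unmapCoef (s ∷ 𝓢) (x , y) = x , unmapCoef 𝓢 y

    mapCoef : (𝓢 : List (Seq A)) → Coef 𝓢 → Coef (map (mapSeq F) 𝓢)
    mapCoef []      _       = _
    mapCoef (s ∷ 𝓢) (x , y) = x , mapCoef 𝓢 y

    unmapCoef-null : ∀ 𝓢 x → Null 𝓢 (unmapCoef 𝓢 x) → Null (map (mapSeq F) 𝓢) x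
    unmapCoef-null []      _       _        = _
    unmapCoef-null (s ∷ 𝓢) (x , y) (n , ns) = n , unmapCoef-null 𝓢 y ns

  module _ {A : Set ℓ₁} where

    splitCoef : (𝓢 𝓣 : List (Seq A)) → Coef (𝓢 ++ 𝓣) → Coef 𝓢 × Coef 𝓣
    splitCoef []      𝓣 z       = _ , z
    splitCoef (s ∷ 𝓢) 𝓣 (x , z) = let y , z′ = splitCoef 𝓢 𝓣 z in (x , y) , z′

    appendCoef : (𝓢 𝓣 : List (Seq A)) → Coef 𝓢 → Coef 𝓣 → Coef (𝓢 ++ 𝓣)
    appendCoef []      𝓣 _       z = z
    appendCoef (s ∷ 𝓢) 𝓣 (x , y) z = x , appendCoef 𝓢 𝓣 y z

    splitCoef-null : ∀ 𝓢 𝓣 x → Null 𝓢 (proj₁ (splitCoef 𝓢 𝓣 x)) → Null 𝓣 (proj₂ (splitCoef 𝓢 𝓣 x)) →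
                     Null (𝓢 ++ 𝓣) x
    splitCoef-null []      𝓣 x       _        n′ = n′
    splitCoef-null (s ∷ 𝓢) 𝓣 (x , y) (n , ns) n′ = n , splitCoef-null 𝓢 𝓣 y ns n′

  module _ {A : Set ℓ₁} where

    lin-splitCoef : ∀ (𝓢 𝓣 : List (Seq (A → Carrier))) x p → lin (𝓢 ++ 𝓣) x p ≈
      lin 𝓢 (proj₁ (splitCoef 𝓢 𝓣 x)) p + lin 𝓣 (proj₂ (splitCoef 𝓢 𝓣 x)) p
    lin-splitCoef []      𝓣 x       p = sym (+-identityˡ _)
    lin-splitCoef (s ∷ 𝓢) 𝓣 (x , y) p = trans (+-congˡ (lin-splitCoef 𝓢 𝓣 y p)) (sym (+-assoc _ _ _))

    lin-appendCoef : ∀ (𝓢 𝓣 : List (Seq (A → Carrier))) x y p →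
      lin (𝓢 ++ 𝓣) (appendCoef 𝓢 𝓣 x y) p ≈ lin 𝓢 x p + lin 𝓣 y p
    lin-appendCoef []      𝓣 _       y p = sym (+-identityˡ _)
    lin-appendCoef (s ∷ 𝓢) 𝓣 (x , z) y p = trans (+-congˡ (lin-appendCoef 𝓢 𝓣 z y p)) (sym (+-assoc _ _ _))

  module _ (P Q : FiniteGradedPoset) (f : Elt P → V Q) where

    private F = extend P Q f

    extend-cong : ∀ {v w} → _≋_ P v w → _≋_ Q (F v) (F w)
    extend-cong {v} {w} v≋w q = trans (extend-∑ P Q f v q)
      (trans (∑-cong (elements P) λ p → *-congʳ (v≋w p)) (sym (extend-∑ P Q f w q)))

    extend-zero : ∀ {v} → _≋_ P v (0ⱽ P) → _≋_ Q (F v) (0ⱽ Q)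
    extend-zero {v} v≋0 q = trans (extend-∑ P Q f v q)
      (∑-zero (elements P) λ p → trans (*-congʳ (v≋0 p)) (zeroˡ _))

    extend-+ : ∀ v w q → F (λ p → v p + w p) q ≈ F v q + F w q
    extend-+ v w q = begin
      F (λ p → v p + w p) q
        ≈⟨ extend-∑ P Q f _ q ⟩
      ∑ (elements P) (λ p → (v p + w p) * f p q)
        ≈⟨ ∑-cong (elements P) (λ p → distribʳ _ _ _) ⟩
      ∑ (elements P) (λ p → v p * f p q + w p * f p q)
        ≈⟨ ∑-+ (elements P) (λ p → v p * f p q) (λ p → w p * f p q) ⟩
      ∑ (elements P) (λ p → v p * f p q) + ∑ (elements P) (λ p → w p * f p q)
        ≈⟨ +-cong (extend-∑ P Q f v q) (extend-∑ P Q f w q) ⟨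
      F v q + F w q ∎

    extend-* : ∀ y v q → F (λ p → y * v p) q ≈ y * F v q
    extend-* y v q = begin
      F (λ p → y * v p) q                          ≈⟨ extend-∑ P Q f _ q ⟩
      ∑ (elements P) (λ p → y * v p * f p q)       ≈⟨ ∑-cong (elements P) (λ p → *-assoc _ _ _) ⟩
      ∑ (elements P) (λ p → y * (v p * f p q))     ≈⟨ *-distribˡ-∑ (elements P) y (λ p → v p * f p q) ⟨
      y * ∑ (elements P) (λ p → v p * f p q)       ≈⟨ *-congˡ (extend-∑ P Q f v q) ⟨
      y * F v q                                    ∎

    extend-sum : ∀ {m} (x : Vector Carrier m) (v : Vector (V P) m) q →
                 F (λ p → sum (λ i → x i * v i p)) q ≈ sum (λ i → x i * F (v i) q)
    extend-sum {zero}  x v q = extend-zero (λ _ → refl) q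
    extend-sum {suc m} x v q = trans
      (extend-+ (λ p → x Fin.zero * v Fin.zero p) (λ p → sum (λ i → x (Fin.suc i) * v (Fin.suc i) p)) q)
      (+-cong (extend-* (x Fin.zero) (v Fin.zero) q)
              (extend-sum (x ∘ Fin.suc) (v ∘ Fin.suc) q))

    extend-lin : ∀ 𝓢 y q → F (lin 𝓢 y) q ≈ lin (map (mapSeq F) 𝓢) (mapCoef F 𝓢 y) q
    extend-lin []            _       q = extend-zero (λ _ → refl) q
    extend-lin ((l , v) ∷ 𝓢) (x , y) q = trans (extend-+ (chainSum (l , v) x) (lin 𝓢 y) q)
      (+-cong (extend-sum x v q) (extend-lin 𝓢 y q))

    lin-map : ∀ 𝓢 y q → lin (map (mapSeq F) 𝓢) y q ≈ F (lin 𝓢 (unmapCoef F 𝓢 y)) q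
    lin-map []            _       q = sym (extend-zero (λ _ → refl) q)
    lin-map ((l , v) ∷ 𝓢) (x , y) q = sym (trans (extend-+ (chainSum (l , v) x) (lin 𝓢 (unmapCoef F 𝓢 y)) q)
      (+-cong (extend-sum x v q) (sym (lin-map 𝓢 y q))))

  -- Natural scalars and symmetric chains

  fromℕ-+ : ∀ m n → fromℕᴿ (m ℕ.+ n) ≈ fromℕᴿ m + fromℕᴿ n
  fromℕ-+ = ×-homo-+ 1#

  fromℕ-* : ∀ m n → fromℕᴿ (m ℕ.* n) ≈ fromℕᴿ m * fromℕᴿ n
  fromℕ-* = ×1-homo-*

  -- The part of a symmetric Jordan chain that passes through θ and ψ: ranks are explicit and the
  -- total rank `d` is a parameter. Nonvanishing is left out, because it is recovered later from
  -- independence.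
  record Chain (P : FiniteGradedPoset) (d : ℕ) (s : Seq (V P)) : Set ℓ where
    private
      l = proj₁ s
      v = proj₂ s
    field
      bottom    : ℕ
      ranks     : ∀ i → HasRank P (v i) (bottom ℕ.+ toℕ i)
      symmetric : bottom ℕ.+ (bottom ℕ.+ l) ≡ d
      step      : ∀ (i : Fin l) → _≋_ P (U P (v (inject₁ i))) (v (Fin.suc i))
      end       : _≋_ P (U P (v (fromℕ l))) (0ⱽ P)

  module _ {P : FiniteGradedPoset} where

    Chain⇒IsSymmetricJordanChain : ∀ {s} → (∀ i → ¬ (_≋_ P (proj₂ s i) (0ⱽ P))) →
      Chain P (maxRank P) s → IsSymmetricJordanChain P s
    Chain⇒IsSymmetricJordanChain {l , v} v≉0 ch = record
      { isGradedJordanChain = record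
        { nonzero     = v≉0
        ; homogeneous = λ i → bottom ℕ.+ toℕ i , ranks i
        ; step        = step
        ; end         = end
        }
      ; symmetric = ≡.trans
          (cong₂ (λ a b → a ℕ.+ (bottom ℕ.+ b)) (ℕ.+-identityʳ bottom) (Fin.toℕ-fromℕ l)) symmetric
      }
      where open Chain ch

    zeroCoef : (𝓢 : List (Seq (V P))) → Coef 𝓢
    zeroCoef []      = _
    zeroCoef (s ∷ 𝓢) = (λ _ → 0#) , zeroCoef 𝓢

    lin-zeroCoef : ∀ 𝓢 p → lin 𝓢 (zeroCoef 𝓢) p ≈ 0#
    lin-zeroCoef []      p = refl
    lin-zeroCoef ((l , v) ∷ 𝓢) p = +-zero (sum-zero {f = λ i → 0# * v i p} λ i → zeroˡ _) (lin-zeroCoef 𝓢 p)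

    -- Were `v i` zero, the coefficients with `1#` at `i` and zero elsewhere would give the zero
    -- vector, and independence would yield `1# ≈ 0#`. Independence passes to the tail by padding
    -- with zeros.
    independent⇒nonzero : ¬ (1# ≈ 0#) → ∀ 𝓢 → (∀ x → (∀ p → lin 𝓢 x p ≈ 0#) → Null 𝓢 x) →
      All (λ s → ∀ i → ¬ (_≋_ P (proj₂ s i) (0ⱽ P))) 𝓢
    independent⇒nonzero 1≉0 []            _ = []
    independent⇒nonzero 1≉0 ((l , v) ∷ 𝓢) independent =
        (λ i vᵢ≋0 → 1≉0 (trans (sym (ind-yes (i Fin.≟ i) ≡.refl)) (proj₁ (independent
          ((λ j → ind (i Fin.≟ j)) , zeroCoef 𝓢)
          (λ p → +-zero (sum-zero λ j → vanish i vᵢ≋0 p j (i Fin.≟ j)) (lin-zeroCoef 𝓢 p))) i)))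
      ∷ independent⇒nonzero 1≉0 𝓢 (λ x x≋0 → proj₂ (independent ((λ _ → 0#) , x)
          (λ p → +-zero (sum-zero {f = λ i → 0# * v i p} λ i → zeroˡ _) (x≋0 p))))
      where
      vanish : ∀ i → _≋_ P (v i) (0ⱽ P) → ∀ p j (d : Dec (i ≡ j)) → ind d * v j p ≈ 0#
      vanish i vᵢ≋0 p j (yes ≡.refl) = *-zeroʳ (vᵢ≋0 p)
      vanish i vᵢ≋0 p j (no _)       = zeroˡ _

  -- Integrality

  Integral : Carrier → Set ℓ
  Integral x = ∃ λ z → x ≈ fromℤᴿ z

  -- Integer addition with mixed signs computes to `_⊖_`; this supplies those two cases of
  -- `fromℤ-+`.
  fromℤ-⊖ : ∀ m n → fromℤᴿ (m ℤ.⊖ n) ≈ fromℕᴿ m - fromℕᴿ n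
  fromℤ-⊖ m zero = trans (reflexive (cong fromℤᴿ (ℤ.⊖-≥ {m} ℕ.z≤n)))
    (sym (trans (+-congˡ -0#≈0#) (+-identityʳ _)))
  fromℤ-⊖ zero (suc n) = sym (+-identityˡ _)
  fromℤ-⊖ (suc m) (suc n) = begin
    fromℤᴿ (suc m ℤ.⊖ suc n)              ≡⟨ cong fromℤᴿ (ℤ.[1+m]⊖[1+n]≡m⊖n m n) ⟩
    fromℤᴿ (m ℤ.⊖ n)                      ≈⟨ fromℤ-⊖ m n ⟩
    fromℕᴿ m - fromℕᴿ n                   ≈⟨ cancel (fromℕᴿ m) (fromℕᴿ n) ⟨
    (1# + fromℕᴿ m) - (1# + fromℕᴿ n)     ∎
    where
    cancel : ∀ x y → (1# + x) - (1# + y) ≈ x - y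
    cancel x y = begin
      (1# + x) + - (1# + y)       ≈⟨ +-cong (+-comm 1# x) (sym (-‿+-comm 1# y)) ⟩
      (x + 1#) + (- 1# + - y)     ≈⟨ +-assoc _ _ _ ⟩
      x + (1# + (- 1# + - y))     ≈⟨ +-congˡ (+-assoc _ _ _) ⟨
      x + ((1# + - 1#) + - y)     ≈⟨ +-congˡ (+-congʳ (-‿inverseʳ 1#)) ⟩
      x + (0# + - y)              ≈⟨ +-congˡ (+-identityˡ _) ⟩
      x - y                       ∎

  fromℤ-neg : ∀ z → fromℤᴿ (ℤ.- z) ≈ - fromℤᴿ z
  fromℤ-neg (+ zero)  = sym -0#≈0#
  fromℤ-neg (+ suc m) = refl
  fromℤ-neg -[1+ m ]  = sym (-‿involutive _)

  fromℤ-+ : ∀ y z → fromℤᴿ (y ℤ.+ z) ≈ fromℤᴿ y + fromℤᴿ z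
  fromℤ-+ (+ m)    (+ n)    = fromℕ-+ m n
  fromℤ-+ (+ m)    -[1+ n ] = fromℤ-⊖ m (suc n)
  fromℤ-+ -[1+ m ] (+ n)    = trans (fromℤ-⊖ n (suc m)) (+-comm _ _)
  fromℤ-+ -[1+ m ] -[1+ n ] = trans (-‿cong (trans
    (reflexive (cong (fromℕᴿ ∘ suc) (≡.sym (ℕ.+-suc m n)))) (fromℕ-+ (suc m) (suc n))))
    (sym (-‿+-comm _ _))

  fromℤ-*-+ : ∀ m z → fromℤᴿ (+ m ℤ.* z) ≈ fromℕᴿ m * fromℤᴿ z
  fromℤ-*-+ m (+ n)    = trans (reflexive (cong fromℤᴿ (≡.sym (ℤ.pos-* m n)))) (fromℕ-* m n)
  fromℤ-*-+ m -[1+ n ] = begin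
    fromℤᴿ (+ m ℤ.* -[1+ n ])          ≡⟨ cong fromℤᴿ (ℤ.neg-distribʳ-* (+ m) (+ suc n)) ⟨
    fromℤᴿ (ℤ.- (+ m ℤ.* + suc n))     ≈⟨ fromℤ-neg (+ m ℤ.* + suc n) ⟩
    - fromℤᴿ (+ m ℤ.* + suc n)         ≈⟨ -‿cong (fromℤ-*-+ m (+ suc n)) ⟩
    - (fromℕᴿ m * fromℕᴿ (suc n))      ≈⟨ -‿distribʳ-* _ _ ⟩
    fromℕᴿ m * - fromℕᴿ (suc n)        ∎

  fromℤ-* : ∀ y z → fromℤᴿ (y ℤ.* z) ≈ fromℤᴿ y * fromℤᴿ z
  fromℤ-* (+ m)    z = fromℤ-*-+ m z
  fromℤ-* -[1+ m ] z = begin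
    fromℤᴿ (-[1+ m ] ℤ.* z)            ≡⟨ cong fromℤᴿ (ℤ.neg-distribˡ-* (+ suc m) z) ⟨
    fromℤᴿ (ℤ.- (+ suc m ℤ.* z))       ≈⟨ fromℤ-neg (+ suc m ℤ.* z) ⟩
    - fromℤᴿ (+ suc m ℤ.* z)           ≈⟨ -‿cong (fromℤ-*-+ (suc m) z) ⟩
    - (fromℕᴿ (suc m) * fromℤᴿ z)      ≈⟨ -‿distribˡ-* _ _ ⟩
    - fromℕᴿ (suc m) * fromℤᴿ z        ∎

  integral-ℕ : ∀ m → Integral (fromℕᴿ m)
  integral-ℕ m = + m , refl

  integral-+ : ∀ {x y} → Integral x → Integral y → Integral (x + y)
  integral-+ (a , x≈a) (b , y≈b) = a ℤ.+ b , trans (+-cong x≈a y≈b) (sym (fromℤ-+ a b))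

  integral-* : ∀ {x y} → Integral x → Integral y → Integral (x * y)
  integral-* (a , x≈a) (b , y≈b) = a ℤ.* b , trans (*-cong x≈a y≈b) (sym (fromℤ-* a b))

  integral-neg : ∀ {x} → Integral x → Integral (- x)
  integral-neg (a , x≈a) = ℤ.- a , trans (-‿cong x≈a) (sym (fromℤ-neg a))

  integral-ind : ∀ (d : Dec A) → Integral (ind d)
  integral-ind (yes _) = + 1 , sym (+-identityʳ 1#)
  integral-ind (no _)  = + 0 , refl

  integral-sum : ∀ {n} {x : Vector Carrier n} → (∀ i → Integral (x i)) → Integral (sum x)
  integral-sum {zero}  h = + 0 , refl
  integral-sum {suc n} h = integral-+ (h Fin.zero) (integral-sum (h ∘ Fin.suc))

  integral-extend : ∀ P Q f v → (∀ p → IsIntegral Q (f p)) → IsIntegral P v → IsIntegral Q (extend P Q f v)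
  integral-extend P Q f v fℤ vℤ q = integral-sum
    {x = λ i → v (lookup (elements P) i) * f (lookup (elements P) i) q} (λ i → integral-* (vℤ _) (fℤ _ q))

  -- Posets that are chains

  sum-single : ∀ {n} {f : Vector Carrier n} i → (∀ j → j ≢ i → f j ≈ 0#) → sum f ≈ f i
  sum-single {n} {f} i f≈0 = trans (sym (∑-tabulate id f)) (∑-single (allFin⁺ n) (∈-allFin i) f≈0)

  module _ (P : FiniteGradedPoset) {l} (e : Fin (suc l) → Elt P)
           (rank-e : ∀ i → rank P (e i) ≡ toℕ i)
           (e-surjective : ∀ p → ∃ λ i → e i ≡ p)
           (U-e : ∀ v i → U P v (e i) ≈ below (v ∘ e) i) where

    e-injective : ∀ {i j} → e i ≡ e j → i ≡ j
    e-injective {i} {j} eq = Fin.toℕ-injective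
      (≡.trans (≡.sym (rank-e i)) (≡.trans (cong (rank P) eq) (rank-e j)))

    δ-e : ∀ i j → δ P (e i) (e j) ≈ ind (i Fin.≟ j)
    δ-e i j with i Fin.≟ j
    ... | yes ≡.refl = ind-yes (_≟_ P (e i) (e i)) ≡.refl
    ... | no i≢j = ind-no (_≟_ P (e i) (e j)) (i≢j ∘ e-injective)

    -- `e` enumerates the poset upwards, and `U-e` says that `U` shifts coefficients along it. The
    -- base cases `M 1 k`, `M₂ 0 q` and `M₂ (suc p) 0` are all of this kind.
    chain-standard : Chain P l (l , λ i → δ P (e i))
    chain-standard = record
      { bottom    = 0
      ; ranks     = λ i p r≢i → ind-no (_≟_ P (e i) p) (λ { ≡.refl → r≢i (rank-e i) })
      ; symmetric = ≡.refl
      ; step      = λ i p → step′ i (e-surjective p)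
      ; end       = λ p → end′ (e-surjective p)
      }
      where
      step′ : ∀ i {p} → ∃ (λ m → e m ≡ p) → U P (δ P (e (inject₁ i))) p ≈ δ P (e (Fin.suc i)) p
      step′ i (m , ≡.refl) = trans (U-e (δ P (e (inject₁ i))) m) (go m)
        where
        go : ∀ m → below (δ P (e (inject₁ i)) ∘ e) m ≈ δ P (e (Fin.suc i)) (e m)
        go Fin.zero    = sym (δ-e (Fin.suc i) Fin.zero)
        go (Fin.suc m) with i Fin.≟ m
        ... | yes ≡.refl = trans (ind-yes (_≟_ P _ _) ≡.refl) (sym (ind-yes (_≟_ P _ _) ≡.refl))
        ... | no i≢m = trans
          (ind-no (_≟_ P _ _) (i≢m ∘ Fin.inject₁-injective ∘ e-injective))
          (sym (ind-no (_≟_ P _ _) (i≢m ∘ Fin.suc-injective ∘ e-injective)))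

      end′ : ∀ {p} → ∃ (λ m → e m ≡ p) → U P (δ P (e (fromℕ l))) p ≈ 0#
      end′ (m , ≡.refl) = trans (U-e (δ P (e (fromℕ l))) m) (go m)
        where
        go : ∀ m → below (δ P (e (fromℕ l)) ∘ e) m ≈ 0#
        go Fin.zero    = refl
        go (Fin.suc m) = ind-no (_≟_ P _ _) (Fin.fromℕ≢inject₁ ∘ e-injective)

    basis-standard : Basis ((l , λ i → δ P (e i)) ∷ [])
    basis-standard = record
      { independent = λ (x , _) x≋0 → (λ i → trans (sym (coefficient x i)) (x≋0 (e i))) , _
      ; spanning    = λ v → (v ∘ e , _) , λ p → covered v (e-surjective p)
      }
      where
      coefficient : ∀ x i → chainSum (l , λ i → δ P (e i)) x (e i) + 0# ≈ x i
      coefficient x i = trans (+-identityʳ _) (trans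
        (sum-single {f = λ j → x j * δ P (e j) (e i)} i λ j j≢i →
          *-zeroʳ (ind-no (_≟_ P _ _) (j≢i ∘ e-injective)))
        (*-oneʳ (ind-yes (_≟_ P _ _) ≡.refl)))

      covered : ∀ v {p} → ∃ (λ m → e m ≡ p) → chainSum (l , λ i → δ P (e i)) (v ∘ e) p + 0# ≈ v p
      covered v (i , ≡.refl) = coefficient (v ∘ e) i

  U-M0 : ∀ k v → U (M 0 k) v tt ≈ 0#
  U-M0 k v = trans (U-formula (M 0 k) v tt)
    (∑-zero (elements (M 0 k)) λ p → *-zeroʳ (ind-no (_⋖?_ (M 0 k) p tt) λ ((_ , tt≢tt) , _) → tt≢tt ≡.refl))

  U-M1 : ∀ k v i → U (M 1 k) v (tt , i) ≈ below (λ i → v (tt , i)) i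
  U-M1 k v i = trans (U-suc 0 k v tt i) (trans (+-congʳ (U-M0 (init k) _)) (+-identityˡ _))

  U-M₂ : ∀ p q v i j → U (M₂ p q) v ⟨ i , j ⟩ ≈ below (λ i → v ⟨ i , j ⟩) i + below (λ j → v ⟨ i , j ⟩) j
  U-M₂ p q v i j = trans (U-suc 1 k v (tt , i) j)
    (+-congʳ (U-M1 (init k) (λ a → v (a , j)) i))
    where k = p Vector.∷ q Vector.∷ Vector.[]

  -- Vectors of V(M(2,p,q)) as functions on ℕ × ℕ

  at : ∀ {n} → Vector Carrier n → ℕ → Carrier
  at {zero}  f i       = 0#
  at {suc n} f zero    = f Fin.zero
  at {suc n} f (suc i) = at (Vector.tail f) i

  at-toℕ : ∀ {n} (f : Vector Carrier n) i → at f (toℕ i) ≡ f i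
  at-toℕ f Fin.zero    = ≡.refl
  at-toℕ f (Fin.suc i) = at-toℕ (Vector.tail f) i

  at-≥ : ∀ {n} (f : Vector Carrier n) {i} → n ℕ.≤ i → at f i ≈ 0#
  at-≥ {zero}  f _           = refl
  at-≥ {suc n} f (ℕ.s≤s n≤i) = at-≥ (Vector.tail f) n≤i

  at-< : ∀ {n} (f : Vector Carrier n) (F : ℕ → Carrier) → (∀ i → f i ≈ F (toℕ i)) →
         ∀ {i} → i ℕ.< n → at f i ≈ F i
  at-< {suc n} f F f≈F {zero}  _           = f≈F Fin.zero
  at-< {suc n} f F f≈F {suc i} (ℕ.s≤s i<n) = at-< (Vector.tail f) (F ∘ suc) (f≈F ∘ Fin.suc) i<n

  at-zero : ∀ {n} (f : Vector Carrier n) → (∀ i → f i ≈ 0#) → ∀ i → at f i ≈ 0#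
  at-zero {zero}  f f≈0 i       = refl
  at-zero {suc n} f f≈0 zero    = f≈0 Fin.zero
  at-zero {suc n} f f≈0 (suc i) = at-zero (Vector.tail f) (f≈0 ∘ Fin.suc) i

  shift : (ℕ → Carrier) → ℕ → Carrier
  shift F zero    = 0#
  shift F (suc i) = F i

  module _ {p q : ℕ} where

    -- Extension by zero outside the rectangle. It lets the formulas for `U` and θ keep the same
    -- form on the boundary as inside.
    hat : V (M₂ p q) → ℕ → ℕ → Carrier
    hat v i j = at (λ i → at (λ j → v ⟨ i , j ⟩) j) i

    hat-toℕ : ∀ v i j → hat v (toℕ i) (toℕ j) ≡ v ⟨ i , j ⟩
    hat-toℕ v i j = ≡.trans (at-toℕ (λ i → at (λ j → v ⟨ i , j ⟩) (toℕ j)) i) (at-toℕ (λ j → v ⟨ i , j ⟩) j)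

    hat-≥₁ : ∀ v {i} j → suc p ℕ.≤ i → hat v i j ≈ 0#
    hat-≥₁ v j = at-≥ (λ i → at (λ j → v ⟨ i , j ⟩) j)

    hat-≥₂ : ∀ v i {j} → suc q ℕ.≤ j → hat v i j ≈ 0#
    hat-≥₂ v i {j} q<j = at-zero (λ i → at (λ j → v ⟨ i , j ⟩) j) (λ i → at-≥ (λ j → v ⟨ i , j ⟩) q<j) i

    -- The bounds are essential: outside the rectangle `hat v` is zero, while the formula `F` may
    -- take other values.
    hat-≤ : ∀ v (F : ℕ → ℕ → Carrier) →
            (∀ (i : Fin (suc p)) (j : Fin (suc q)) → v ⟨ i , j ⟩ ≈ F (toℕ i) (toℕ j)) →
            ∀ {i j} → i ℕ.≤ p → j ℕ.≤ q → hat v i j ≈ F i j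
    hat-≤ v F v≈F {i} {j} i≤p j≤q =
      at-< (λ i → at (λ j → v ⟨ i , j ⟩) j) (λ i → F i j)
           (λ i → at-< (λ j → v ⟨ i , j ⟩) (F (toℕ i)) (v≈F i) (ℕ.s≤s j≤q)) (ℕ.s≤s i≤p)

    hat-zero : ∀ v → (∀ (i : Fin (suc p)) (j : Fin (suc q)) → v ⟨ i , j ⟩ ≈ 0#) → ∀ i j → hat v i j ≈ 0#
    hat-zero v v≈0 i j = at-zero (λ i → at (λ j → v ⟨ i , j ⟩) j)
      (λ i → at-zero (λ j → v ⟨ i , j ⟩) (v≈0 i) j) i

    U-hat : ∀ v i j → U (M₂ p q) v ⟨ i , j ⟩ ≈
            shift (λ i → hat v i (toℕ j)) (toℕ i) + shift (hat v (toℕ i)) (toℕ j)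
    U-hat v i j = trans (U-M₂ p q v i j) (+-cong (first i) (second j))
      where
      first : ∀ i → below (λ i → v ⟨ i , j ⟩) i ≈ shift (λ i → hat v i (toℕ j)) (toℕ i)
      first Fin.zero    = refl
      first (Fin.suc i) = sym (reflexive (≡.trans
        (cong (λ m → hat v m (toℕ j)) (≡.sym (Fin.toℕ-inject₁ i))) (hat-toℕ v (inject₁ i) j)))

      second : ∀ j → below (λ j → v ⟨ i , j ⟩) j ≈ shift (hat v (toℕ i)) (toℕ j)
      second Fin.zero    = refl
      second (Fin.suc j) = sym (reflexive (≡.trans
        (cong (hat v (toℕ i)) (≡.sym (Fin.toℕ-inject₁ j))) (hat-toℕ v i (inject₁ j))))

  -- The map θ

  extend-rank : ∀ P Q f d → (∀ p → HasRank Q (f p) (d ℕ.+ rank P p)) →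
                ∀ {v m} → HasRank P v m → HasRank Q (extend P Q f v) (d ℕ.+ m)
  extend-rank P Q f d f-rank {v} {m} v-rank q q≢ = trans (extend-∑ P Q f v q) (∑-zero (elements P) term)
    where
    term : ∀ p → v p * f p q ≈ 0#
    term p with rank P p ℕ.≟ m
    ... | yes ≡.refl = *-zeroʳ (f-rank p q q≢)
    ... | no r≢m = *-zeroˡ (v-rank p r≢m)

  module _ (p q : ℕ) where

    private
      S = M₂ p q
      T = M₂ (suc p) (suc q)

    -- The anonymous function in the definition of θ.
    θ-image : Elt S → V T
    θ-image ⟨ i , j ⟩ x =
        fromℕᴿ (suc p ∸ toℕ i)             * δ T ⟨ inject₁ i , Fin.suc j ⟩ x
      - fromℕᴿ (suc q ∸ suc (toℕ j) ℕ.+ 1) * δ T ⟨ Fin.suc i , inject₁ j ⟩ x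

    -- The coefficient `q - j′ + 1` of the algorithm, with `j′ = suc j` and `suc q` for `q`; as
    -- `j ≤ q`, no truncation occurs.
    1+q∸j : ∀ (j : Fin (suc q)) → suc q ∸ suc (toℕ j) ℕ.+ 1 ≡ suc q ∸ toℕ j
    1+q∸j j = ≡.trans (ℕ.+-comm (q ∸ toℕ j) 1) (≡.sym (ℕ.+-∸-assoc 1 (ℕ.≤-pred (Fin.toℕ<n j))))

    -- θ read at the target: `(i , j)` receives the positive term from source `(i , j - 1)` and the
    -- negative term from source `(i - 1 , j)`.
    θ-hat : ∀ w i j → θ p q w ⟨ i , j ⟩ ≈
            fromℕᴿ (suc p ∸ toℕ i) * shift (hat w (toℕ i)) (toℕ j)
            - fromℕᴿ (suc q ∸ toℕ j) * shift (λ i → hat w i (toℕ j)) (toℕ i)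
    θ-hat w i j = begin
      θ p q w ⟨ i , j ⟩
        ≈⟨ extend-∑ S T θ-image w ⟨ i , j ⟩ ⟩
      ∑ (elements S) (λ y → w y * θ-image y ⟨ i , j ⟩)
        ≈⟨ ∑-cong (elements S) (λ y → trans (distribˡ _ _ _)
             (+-congˡ (trans (sym (-‿distribʳ-* _ _)) (neg-1 _)))) ⟩
      ∑ (elements S) (λ y → t₁ y + - 1# * t₂ y)
        ≈⟨ ∑-+ (elements S) t₁ (λ y → - 1# * t₂ y) ⟩
      ∑ (elements S) t₁ + ∑ (elements S) (λ y → - 1# * t₂ y)
        ≈⟨ +-congˡ (*-distribˡ-∑ (elements S) (- 1#) t₂) ⟨
      ∑ (elements S) t₁ + - 1# * ∑ (elements S) t₂
        ≈⟨ +-cong (first (view i) j) (trans (sym (neg-1 _)) (-‿cong (second i (view j)))) ⟩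
      _ ∎
      where
      neg-1 : ∀ x → - x ≈ - 1# * x
      neg-1 x = sym (-1*x≈-x x)

      t₁ t₂ : Elt S → Carrier
      t₁ ⟨ i′ , j′ ⟩ = w ⟨ i′ , j′ ⟩ * (fromℕᴿ (suc p ∸ toℕ i′) * δ T ⟨ inject₁ i′ , Fin.suc j′ ⟩ ⟨ i , j ⟩)
      t₂ ⟨ i′ , j′ ⟩ = w ⟨ i′ , j′ ⟩ *
        (fromℕᴿ (suc q ∸ suc (toℕ j′) ℕ.+ 1) * δ T ⟨ Fin.suc i′ , inject₁ j′ ⟩ ⟨ i , j ⟩)

      first : ∀ {i : Fin (suc (suc p))} → Top.View i → ∀ j →
        ∑ (elements S) (λ (( _ , i′) , j′) → w ⟨ i′ , j′ ⟩ *
          (fromℕᴿ (suc p ∸ toℕ i′) * δ T ⟨ inject₁ i′ , Fin.suc j′ ⟩ ⟨ i , j ⟩)) ≈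
        fromℕᴿ (suc p ∸ toℕ i) * shift (hat w (toℕ i)) (toℕ j)
      first {i} _ Fin.zero = trans
        (∑-zero (elements S) λ ((_ , i′) , j′) → *-zeroʳ (*-zeroʳ
          (ind-no (_≟_ T ⟨ inject₁ i′ , Fin.suc j′ ⟩ ⟨ i , Fin.zero ⟩) λ ())))
        (sym (zeroʳ _))
      -- The largest index is never of the form `inject₁ i′`, so the left side is zero; the right
      -- side is zero because `hat w` vanishes beyond `p`.
      first ‵fromℕ (Fin.suc j) = trans
        (∑-zero (elements S) λ ((_ , i′) , j′) → *-zeroʳ (*-zeroʳ
          (ind-no (_≟_ T ⟨ inject₁ i′ , Fin.suc j′ ⟩ ⟨ fromℕ (suc p) , Fin.suc j ⟩) λ eq →
            Fin.fromℕ≢inject₁ (≡.sym (cong (proj₂ ∘ proj₁) eq)))))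
        (sym (*-zeroʳ (hat-≥₁ w (toℕ j) (ℕ.≤-reflexive (≡.sym (Fin.toℕ-fromℕ (suc p)))))))
      first (‵inject₁ i) (Fin.suc j) = trans
        (∑-elements-single S ⟨ i , j ⟩ λ ((_ , i′) , j′) y≢ → *-zeroʳ (*-zeroʳ
          (ind-no (_≟_ T ⟨ inject₁ i′ , Fin.suc j′ ⟩ ⟨ inject₁ i , Fin.suc j ⟩) λ eq → y≢
          (cong₂ ⟨_,_⟩′ (Fin.inject₁-injective (cong (proj₂ ∘ proj₁) eq)) (Fin.suc-injective (cong proj₂ eq))))))
        (trans (trans (*-congˡ (*-oneʳ (ind-yes (_≟_ T ⟨ inject₁ i , Fin.suc j ⟩ ⟨ inject₁ i , Fin.suc j ⟩) ≡.refl)))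
                      (*-comm _ _)) (reflexive
          (cong₂ (λ a b → fromℕᴿ (suc p ∸ a) * b) (≡.sym (Fin.toℕ-inject₁ i))
            (≡.trans (≡.sym (hat-toℕ w i j)) (cong (λ m → hat w m (toℕ j)) (≡.sym (Fin.toℕ-inject₁ i)))))))
        where
        ⟨_,_⟩′ : Fin (suc p) → Fin (suc q) → Elt S
        ⟨ i , j ⟩′ = ⟨ i , j ⟩

      second : ∀ i {j : Fin (suc (suc q))} → Top.View j →
        ∑ (elements S) (λ (( _ , i′) , j′) → w ⟨ i′ , j′ ⟩ *
          (fromℕᴿ (suc q ∸ suc (toℕ j′) ℕ.+ 1) * δ T ⟨ Fin.suc i′ , inject₁ j′ ⟩ ⟨ i , j ⟩)) ≈
        fromℕᴿ (suc q ∸ toℕ j) * shift (λ i → hat w i (toℕ j)) (toℕ i)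
      second Fin.zero {j} _ = trans
        (∑-zero (elements S) λ ((_ , i′) , j′) → *-zeroʳ (*-zeroʳ
          (ind-no (_≟_ T ⟨ Fin.suc i′ , inject₁ j′ ⟩ ⟨ Fin.zero , j ⟩) λ ())))
        (sym (zeroʳ _))
      second (Fin.suc i) ‵fromℕ = trans
        (∑-zero (elements S) λ ((_ , i′) , j′) → *-zeroʳ (*-zeroʳ
          (ind-no (_≟_ T ⟨ Fin.suc i′ , inject₁ j′ ⟩ ⟨ Fin.suc i , fromℕ (suc q) ⟩) λ eq →
            Fin.fromℕ≢inject₁ (≡.sym (cong proj₂ eq)))))
        (sym (*-zeroʳ (hat-≥₂ w (toℕ i) (ℕ.≤-reflexive (≡.sym (Fin.toℕ-fromℕ (suc q)))))))
      second (Fin.suc i) (‵inject₁ j) = trans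
        (∑-elements-single S ⟨ i , j ⟩ λ ((_ , i′) , j′) y≢ → *-zeroʳ (*-zeroʳ
          (ind-no (_≟_ T ⟨ Fin.suc i′ , inject₁ j′ ⟩ ⟨ Fin.suc i , inject₁ j ⟩) λ eq → y≢
          (cong₂ ⟨_,_⟩′ (Fin.suc-injective (cong (proj₂ ∘ proj₁) eq)) (Fin.inject₁-injective (cong proj₂ eq))))))
        (trans (trans (*-congˡ (*-oneʳ (ind-yes (_≟_ T ⟨ Fin.suc i , inject₁ j ⟩ ⟨ Fin.suc i , inject₁ j ⟩) ≡.refl)))
                      (*-comm _ _)) (reflexive
          (cong₂ (λ a b → fromℕᴿ a * b) (≡.trans (1+q∸j j) (cong (suc q ∸_) (≡.sym (Fin.toℕ-inject₁ j))))
            (≡.trans (≡.sym (hat-toℕ w i j)) (cong (hat w (toℕ i)) (≡.sym (Fin.toℕ-inject₁ j)))))))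
        where
        ⟨_,_⟩′ : Fin (suc p) → Fin (suc q) → Elt S
        ⟨ i , j ⟩′ = ⟨ i , j ⟩

  -- θ commutes with `U`

  *-zero-congˡ : ∀ {x y z} → x ≈ 0# → x * y ≈ x * z
  *-zero-congˡ x≈0 = trans (*-zeroˡ x≈0) (sym (*-zeroˡ x≈0))

  module _ (p q : ℕ) where

    private
      S = M₂ p q
      T = M₂ (suc p) (suc q)

      α β : ℕ → Carrier
      α i = fromℕᴿ (suc p ∸ i)
      β j = fromℕᴿ (suc q ∸ j)

    α-suc : ∀ {i} → i ℕ.≤ p → α i ≈ 1# + α (suc i)
    α-suc i≤p = reflexive (cong fromℕᴿ (ℕ.+-∸-assoc 1 i≤p))

    β-suc : ∀ {j} → j ℕ.≤ q → β j ≈ 1# + β (suc j)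
    β-suc j≤q = reflexive (cong fromℕᴿ (ℕ.+-∸-assoc 1 j≤q))

    α-last : α (suc p) ≈ 0#
    α-last = reflexive (cong fromℕᴿ (ℕ.n∸n≡0 (suc p)))

    β-last : β (suc q) ≈ 0#
    β-last = reflexive (cong fromℕᴿ (ℕ.n∸n≡0 (suc q)))

    -- Here `u` stands for `U w` and `t` for `θ w`. Replacing `α i` by `1# + α (suc i)` and `β j` by
    -- `1# + β (suc j)` produces one surplus copy of `hat w i j` with each sign, and these cancel.
    θ-commutes : ∀ (w u : V S) (t : V T) →
      (∀ i j → u ⟨ i , j ⟩ ≈ shift (λ i → hat w i (toℕ j)) (toℕ i) + shift (hat w (toℕ i)) (toℕ j)) →
      (∀ i j → t ⟨ i , j ⟩ ≈ α (toℕ i) * shift (hat w (toℕ i)) (toℕ j)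
                             - β (toℕ j) * shift (λ i → hat w i (toℕ j)) (toℕ i)) →
      ∀ i j → i ℕ.≤ suc p → j ℕ.≤ suc q →
      shift (λ i → hat t i j) i + shift (hat t i) j ≈
      α i * shift (hat u i) j - β j * shift (λ i → hat u i j) i
    θ-commutes w u t u-hat t-hat = go
      where
      F G : ℕ → ℕ → Carrier
      F i j = α i * shift (hat w i) j - β j * shift (λ i → hat w i j) i
      G i j = shift (λ i → hat w i j) i + shift (hat w i) j

      θw : ∀ {i j} → i ℕ.≤ suc p → j ℕ.≤ suc q → hat t i j ≈ F i j
      θw = hat-≤ t F t-hat

      Uw : ∀ {i j} → i ℕ.≤ p → j ℕ.≤ q → hat u i j ≈ G i j
      Uw = hat-≤ u G u-hat

      -- At `i = suc p` the point lies outside the rectangle of `u`: there `hat u` is zero while `G`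
      -- may not be. The coefficient `α (suc p)`, which is zero, hides the difference. `β-Uw` treats
      -- the other edge in the same way.
      α-Uw : ∀ {i j} → i ℕ.≤ suc p → j ℕ.≤ q → α i * hat u i j ≈ α i * G i j
      α-Uw i≤ j≤ = [ (λ i<1+p → *-congˡ (Uw (ℕ.≤-pred i<1+p) j≤)) , (λ { ≡.refl → *-zero-congˡ α-last }) ]′
        (ℕ.m≤n⇒m<n∨m≡n i≤)

      β-Uw : ∀ {i j} → i ℕ.≤ p → j ℕ.≤ suc q → β j * hat u i j ≈ β j * G i j
      β-Uw i≤ j≤ = [ (λ j<1+q → *-congˡ (Uw i≤ (ℕ.≤-pred j<1+q))) , (λ { ≡.refl → *-zero-congˡ β-last }) ]′
        (ℕ.m≤n⇒m<n∨m≡n j≤)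

      -- A semiring identity with `m` in the place of `- 1#`; for that value the leftover
      -- `(1# + m) * x` vanishes.
      rearrange : ∀ m a b x y z →
        ((1# + a) * x + m * (b * z)) + (a * y + m * ((1# + b) * x)) ≈
        (a * (x + y) + m * (b * (z + x))) + (1# + m) * x
      rearrange = solve 6 (λ m a b x y z →
        ((con 1 :+ a) :* x :+ m :* (b :* z)) :+ (a :* y :+ m :* ((con 1 :+ b) :* x)) :=
        (a :* (x :+ y) :+ m :* (b :* (z :+ x))) :+ (con 1 :+ m) :* x) refl
        where open import Algebra.Solver.Ring.NaturalCoefficients.Default commutativeSemiring

      core : ∀ a b x y z → ((1# + a) * x - b * z) + (a * y - (1# + b) * x) ≈ a * (x + y) - b * (z + x)
      core a b x y z = begin
        ((1# + a) * x - b * z) + (a * y - (1# + b) * x)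
          ≈⟨ +-cong (+-congˡ (-1*x≈-x _)) (+-congˡ (-1*x≈-x _)) ⟨
        ((1# + a) * x + - 1# * (b * z)) + (a * y + - 1# * ((1# + b) * x))
          ≈⟨ rearrange (- 1#) a b x y z ⟩
        (a * (x + y) + - 1# * (b * (z + x))) + (1# + - 1#) * x
          ≈⟨ +-cong (+-congˡ (-1*x≈-x _)) (*-zeroˡ (-‿inverseʳ 1#)) ⟩
        a * (x + y) - b * (z + x) + 0#
          ≈⟨ +-identityʳ _ ⟩
        a * (x + y) - b * (z + x) ∎

      minus-zero : ∀ x → - (x * 0#) ≈ 0#
      minus-zero x = trans (-‿cong (zeroʳ x)) -0#≈0#

      go : ∀ i j → i ℕ.≤ suc p → j ℕ.≤ suc q →
           shift (λ i → hat t i j) i + shift (hat t i) j ≈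
           α i * shift (hat u i) j - β j * shift (λ i → hat u i j) i
      go zero zero _ _ = +-cong (sym (zeroʳ _)) (sym (minus-zero _))
      go zero (suc j) _ (ℕ.s≤s j≤q) = begin
        0# + hat t 0 j
          ≈⟨ +-identityˡ _ ⟩
        hat t 0 j
          ≈⟨ θw ℕ.z≤n (ℕ.m≤n⇒m≤1+n j≤q) ⟩
        α 0 * shift (hat w 0) j - β j * 0#
          ≈⟨ +-cong (*-congˡ (sym (+-identityˡ _))) (trans (minus-zero _) (sym (minus-zero _))) ⟩
        α 0 * G 0 j - β (suc j) * 0#
          ≈⟨ +-congʳ (α-Uw ℕ.z≤n j≤q) ⟨
        α 0 * hat u 0 j - β (suc j) * 0# ∎
      go (suc i) zero (ℕ.s≤s i≤p) _ = begin
        hat t i 0 + 0#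
          ≈⟨ +-identityʳ _ ⟩
        hat t i 0
          ≈⟨ θw (ℕ.m≤n⇒m≤1+n i≤p) ℕ.z≤n ⟩
        α i * 0# - β 0 * shift (λ i → hat w i 0) i
          ≈⟨ +-cong (trans (zeroʳ _) (sym (zeroʳ _))) (-‿cong (*-congˡ (sym (+-identityʳ _)))) ⟩
        α (suc i) * 0# - β 0 * G i 0
          ≈⟨ +-congˡ (-‿cong (β-Uw i≤p ℕ.z≤n)) ⟨
        α (suc i) * 0# - β 0 * hat u i 0 ∎
      go (suc i) (suc j) i≤@(ℕ.s≤s i≤p) j≤@(ℕ.s≤s j≤q) = begin
        hat t i (suc j) + hat t (suc i) j
          ≈⟨ +-cong (θw (ℕ.m≤n⇒m≤1+n i≤p) j≤) (θw i≤ (ℕ.m≤n⇒m≤1+n j≤q)) ⟩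
        F i (suc j) + F (suc i) j
          ≈⟨ +-cong (+-congʳ (*-congʳ (α-suc i≤p))) (+-congˡ (-‿cong (*-congʳ (β-suc j≤q)))) ⟩
        ((1# + α (suc i)) * hat w i j - β (suc j) * shift (λ i → hat w i (suc j)) i)
          + (α (suc i) * shift (hat w (suc i)) j - (1# + β (suc j)) * hat w i j)
          ≈⟨ core (α (suc i)) (β (suc j)) (hat w i j) (shift (hat w (suc i)) j)
               (shift (λ i → hat w i (suc j)) i) ⟩
        α (suc i) * G (suc i) j - β (suc j) * G i (suc j)
          ≈⟨ +-cong (α-Uw i≤ j≤q) (-‿cong (β-Uw i≤p j≤)) ⟨
        α (suc i) * hat u (suc i) j - β (suc j) * hat u i (suc j) ∎

    U-θ : ∀ w → _≋_ T (U T (θ p q w)) (θ p q (U S w))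
    U-θ w ⟨ i , j ⟩ = trans (U-hat (θ p q w) i j) (trans
      (θ-commutes w (U S w) (θ p q w) (U-hat w) (θ-hat p q w) (toℕ i) (toℕ j)
        (ℕ.≤-pred (Fin.toℕ<n i)) (ℕ.≤-pred (Fin.toℕ<n j)))
      (sym (θ-hat p q (U S w) i j)))

    θ-image-rank : ∀ y → HasRank T (θ-image p q y) (suc (rank S y))
    θ-image-rank ⟨ i , j ⟩ x r≢ = trans (+-cong
      (*-zeroʳ (ind-no (_≟_ T ⟨ inject₁ i , Fin.suc j ⟩ x) λ { ≡.refl → r≢
        (≡.trans (ℕ.+-suc _ (toℕ j)) (cong (λ m → suc (m ℕ.+ toℕ j)) (Fin.toℕ-inject₁ i))) }))
      (-‿cong (*-zeroʳ (ind-no (_≟_ T ⟨ Fin.suc i , inject₁ j ⟩ x) λ { ≡.refl → r≢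
        (cong (λ m → suc (toℕ i ℕ.+ m)) (Fin.toℕ-inject₁ j)) }))))
      (trans (+-identityˡ _) -0#≈0#)

    θ-rank : ∀ {w m} → HasRank S w m → HasRank T (θ p q w) (suc m)
    θ-rank = extend-rank S T (θ-image p q) 1 θ-image-rank

    -- θ raises both end ranks by one, and the rank of the poset grows by two.
    θ-chain : ∀ {s} → Chain S (p ℕ.+ q) s → Chain T (suc p ℕ.+ suc q) (mapSeq (θ p q) s)
    θ-chain {l , v} ch = record
      { bottom    = suc bottom
      ; ranks     = θ-rank ∘ ranks
      ; symmetric = ≡.trans (cong suc (ℕ.+-suc bottom (bottom ℕ.+ l)))
          (≡.trans (cong (suc ∘ suc) symmetric) (cong suc (≡.sym (ℕ.+-suc p q))))
      ; step      = λ i x → trans (U-θ (v (inject₁ i)) x)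
          (extend-cong S T (θ-image p q) (step i) x)
      ; end       = λ x → trans (U-θ (v (fromℕ l)) x) (extend-zero S T (θ-image p q) end x)
      }
      where open Chain ch

    θ-integral : ∀ {w} → IsIntegral S w → IsIntegral T (θ p q w)
    θ-integral {w} = integral-extend S T (θ-image p q) w λ ( (_ , i) , j) x → integral-+
      (integral-* (integral-ℕ (suc p ∸ toℕ i)) (integral-ind (_≟_ T ⟨ inject₁ i , Fin.suc j ⟩ x)))
      (integral-neg (integral-* (integral-ℕ (suc q ∸ suc (toℕ j) ℕ.+ 1))
                                (integral-ind (_≟_ T ⟨ Fin.suc i , inject₁ j ⟩ x))))

    -- The binomial chain

    -- A coefficient of the binomial vector, with the rank `s` as an argument of its own in place of
    -- `j`; in this form Pascal's rule applies directly.
    entry : ℕ → ℕ → ℕ → Carrier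
    entry k i s = if does (s ℕ.≟ k) then fromℕᴿ (k C i) else 0#

    entry-yes : ∀ {k i s} → s ≡ k → entry k i s ≈ fromℕᴿ (k C i)
    entry-yes {k} {i} {s} s≡k = go (s ℕ.≟ k)
      where
      go : (d : Dec (s ≡ k)) → (if does d then fromℕᴿ (k C i) else 0#) ≈ fromℕᴿ (k C i)
      go (yes _)  = refl
      go (no s≢k) = ⊥-elim (s≢k s≡k)

    entry-no : ∀ {k i s} → s ≢ k → entry k i s ≈ 0#
    entry-no {k} {i} {s} s≢k = go (s ℕ.≟ k)
      where
      go : (d : Dec (s ≡ k)) → (if does d then fromℕᴿ (k C i) else 0#) ≈ 0#
      go (yes s≡k) = ⊥-elim (s≢k s≡k)
      go (no _)    = refl

    entry-pascal : ∀ k i s → entry k i s + entry k (suc i) s ≈ entry (suc k) (suc i) (suc s)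
    entry-pascal k i s with does (s ℕ.≟ k)
    ... | true  = trans (sym (fromℕ-+ (k C i) (k C suc i)))
                        (reflexive (cong fromℕᴿ (nCk+nC[k+1]≡[n+1]C[k+1] k i)))
    ... | false = +-identityˡ 0#

    entry-left : ∀ k s → entry k 0 s ≈ entry (suc k) 0 (suc s)
    entry-left k s with does (s ℕ.≟ k)
    ... | true  = refl
    ... | false = refl

    entry-top : ∀ k i → entry k i i ≈ entry (suc k) (suc i) (suc i)
    entry-top k i = go (i ℕ.≟ k)
      where
      go : Dec (i ≡ k) → entry k i i ≈ entry (suc k) (suc i) (suc i)
      go (yes ≡.refl) = trans (entry-yes {i} {i} ≡.refl) (trans
        (reflexive (cong fromℕᴿ (≡.trans (nCn≡1 i) (≡.sym (nCn≡1 (suc i))))))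
        (sym (entry-yes {suc i} {suc i} ≡.refl)))
      go (no i≢k) = trans (entry-no {i = i} i≢k) (sym (entry-no {i = suc i} (i≢k ∘ ℕ.suc-injective)))

    -- The coefficient at `(i , j)` counts the lattice paths from `(0 , 0)`, so this is Pascal's
    -- rule; on the two edges only one lower neighbour is present.
    U-binomial : ∀ k → _≋_ T (U T (binomialVector p q k)) (binomialVector p q (suc k))
    U-binomial k ⟨ i , j ⟩ = trans (U-M₂ (suc p) (suc q) (binomialVector p q k) i j) (go i j)
      where
      go : ∀ i j → below (λ i → binomialVector p q k ⟨ i , j ⟩) i
                 + below (λ j → binomialVector p q k ⟨ i , j ⟩) j ≈ binomialVector p q (suc k) ⟨ i , j ⟩
      go Fin.zero Fin.zero = +-identityˡ 0#
      go Fin.zero (Fin.suc j) = trans (+-identityˡ _) (trans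
        (reflexive (cong (entry k 0) (Fin.toℕ-inject₁ j))) (entry-left k (toℕ j)))
      go (Fin.suc i) Fin.zero = trans (+-identityʳ _) (trans
        (reflexive (cong₂ (entry k) (Fin.toℕ-inject₁ i)
          (≡.trans (ℕ.+-identityʳ _) (Fin.toℕ-inject₁ i))))
        (trans (entry-top k (toℕ i))
          (reflexive (cong (entry (suc k) (suc (toℕ i)) ∘ suc) (≡.sym (ℕ.+-identityʳ (toℕ i)))))))
      go (Fin.suc i) (Fin.suc j) = trans
        (+-cong (reflexive (cong (λ m → entry k m (m ℕ.+ suc (toℕ j))) (Fin.toℕ-inject₁ i)))
                (reflexive (cong (entry k (suc (toℕ i))) (≡.trans
                  (cong (suc (toℕ i) ℕ.+_) (Fin.toℕ-inject₁ j)) (≡.sym (ℕ.+-suc (toℕ i) (toℕ j)))))))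
        (entry-pascal k (toℕ i) (toℕ i ℕ.+ suc (toℕ j)))

    binomial-rank : ∀ k → HasRank T (binomialVector p q k) k
    binomial-rank k ⟨ i , j ⟩ r≢k = entry-no {k} {toℕ i} r≢k

    binomialSeq : Seq (V T)
    binomialSeq = suc p ℕ.+ suc q , λ k → binomialVector p q (toℕ k)

    binomial-chain : Chain T (suc p ℕ.+ suc q) binomialSeq
    binomial-chain = record
      { bottom    = 0
      ; ranks     = λ k → binomial-rank (toℕ k)
      ; symmetric = ≡.refl
      ; step      = λ k x → trans (U-binomial (toℕ (inject₁ k)) x)
          (reflexive (cong (λ m → binomialVector p q (suc m) x) (Fin.toℕ-inject₁ k)))
      -- The next binomial vector would live in a rank above the top of the poset, so all its
      -- entries are zero.
      ; end       = λ x → trans (U-binomial _ x) (binomial-rank (suc (toℕ (fromℕ (suc p ℕ.+ suc q)))) x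
          (ℕ.<⇒≢ (ℕ.s≤s (ℕ.≤-trans (box-rank≤total 2 (suc p Vector.∷ suc q Vector.∷ Vector.[]) x)
            (ℕ.≤-reflexive (≡.sym (Fin.toℕ-fromℕ (suc p ℕ.+ suc q))))))))
      }

    binomial-integral : ∀ k → IsIntegral T (binomialVector p q k)
    binomial-integral k ⟨ i , j ⟩ with does (toℕ i ℕ.+ toℕ j ℕ.≟ k)
    ... | true  = integral-ℕ (k C toℕ i)
    ... | false = integral-ℕ 0

  -- Chains and integrality for `𝓙`

  𝓙-chains : ∀ p q → All (Chain (M₂ p q) (p ℕ.+ q)) (𝓙 p q)
  𝓙-chains zero    q       = chain-standard (M₂ 0 q) (λ j → ⟨ Fin.zero , j ⟩) (λ _ → ≡.refl)
    (λ { ⟨ Fin.zero , j ⟩ → j , ≡.refl })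
    (λ v j → trans (U-M₂ 0 q v Fin.zero j) (+-identityˡ _)) ∷ []
  𝓙-chains (suc p) zero    = subst
    (λ d → Chain (M₂ (suc p) 0) d (suc p , λ i → δ (M₂ (suc p) 0) ⟨ i , Fin.zero ⟩))
    (≡.sym (ℕ.+-identityʳ (suc p)))
    (chain-standard (M₂ (suc p) 0) (λ i → ⟨ i , Fin.zero ⟩)
      (λ i → ℕ.+-identityʳ (toℕ i)) (λ { ⟨ i , Fin.zero ⟩ → i , ≡.refl })
      (λ v i → trans (U-M₂ (suc p) 0 v i Fin.zero) (+-identityʳ _))) ∷ []
  𝓙-chains (suc p) (suc q) =
    binomial-chain p q ∷ All.map⁺ (All.map (θ-chain p q) (𝓙-chains p q))

  IsIntegralSeq : ∀ P → Seq (V P) → Set ℓ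
  IsIntegralSeq P (l , v) = ∀ i → IsIntegral P (v i)

  𝓙-integral : ∀ p q → All (IsIntegralSeq (M₂ p q)) (𝓙 p q)
  𝓙-integral zero    q       = (λ j x → integral-ind (_≟_ (M₂ 0 q) ⟨ Fin.zero , j ⟩ x)) ∷ []
  𝓙-integral (suc p) zero    = (λ i x → integral-ind (_≟_ (M₂ (suc p) 0) ⟨ i , Fin.zero ⟩ x)) ∷ []
  𝓙-integral (suc p) (suc q) =
      (λ k → binomial-integral p q (toℕ k))
    ∷ All.map⁺ (All.map (λ vℤ i → θ-integral p q (vℤ i)) (𝓙-integral p q))

  -- Scalars in which the positive integers are invertible

  module WithInverses (ι : ℕ → Carrier) (ι-inverse : ∀ m → ι m * fromℕᴿ (suc m) ≈ 1#) where

    cancel-ι : ∀ m x → ι m * (fromℕᴿ (suc m) * x) ≈ x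
    cancel-ι m x = trans (sym (*-assoc _ _ _)) (trans (*-congʳ (ι-inverse m)) (*-identityˡ x))

    cancel-ι′ : ∀ m x → fromℕᴿ (suc m) * (ι m * x) ≈ x
    cancel-ι′ m x = trans (sym (*-assoc _ _ _)) (trans
      (*-congʳ (trans (*-comm _ _) (ι-inverse m))) (*-identityˡ x))

    fromℕ-cancel : ∀ {n x} → 0 ℕ.< n → fromℕᴿ n * x ≈ 0# → x ≈ 0#
    fromℕ-cancel {suc m} {x} _ nx≈0 = trans (sym (cancel-ι m x)) (*-zeroʳ nx≈0)

    opaque
      unfolding ∑

      ∑-fromℕ : ∀ {A : Set} (xs : List A) (h : A → ℕ) → ∑ xs (λ x → fromℕᴿ (h x)) ≈ fromℕᴿ (sumℕ (map h xs))
      ∑-fromℕ []       h = refl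
      ∑-fromℕ (x ∷ xs) h = trans (+-congˡ (∑-fromℕ xs h)) (sym (fromℕ-+ (h x) (sumℕ (map h xs))))

    module _ (p q : ℕ) where

      private
        S = M₂ p q
        T = M₂ (suc p) (suc q)

        α β : ℕ → Carrier
        α i = fromℕᴿ (suc p ∸ i)
        β j = fromℕᴿ (suc q ∸ j)

      -- Injectivity of θ and partial solution of θ w = u

      private
        F : V S → ℕ → ℕ → Carrier
        F w i j = α i * shift (hat w i) j - β j * shift (λ i → hat w i j) i

      -- The entry of `θ p q w` at `(i , suc j)` is `α i` times the entry of `w` at `(i , j)` minus
      -- a multiple of the one at `(i - 1 , suc j)`. The system is triangular in `i`, with positive
      -- integers `α i` on the diagonal for `i ≤ p`.
      θ-injective : ∀ w → _≋_ T (θ p q w) (0ⱽ T) → _≋_ S w (0ⱽ S)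
      θ-injective w θw≋0 ⟨ i , j ⟩ = trans (sym (reflexive (hat-toℕ w i j)))
        (go (toℕ i) (toℕ j) (ℕ.≤-pred (Fin.toℕ<n i)) (ℕ.≤-pred (Fin.toℕ<n j)))
        where
        F≈0 : ∀ {i j} → i ℕ.≤ suc p → j ℕ.≤ suc q → F w i j ≈ 0#
        F≈0 {i} {j} i≤ j≤ = trans (sym (hat-≤ (θ p q w) (F w) (θ-hat p q w) i≤ j≤))
          (hat-zero (θ p q w) (λ i j → θw≋0 ⟨ i , j ⟩) i j)

        first≈0 : ∀ {x y z} → y ≈ 0# → x - z * y ≈ 0# → x ≈ 0#
        first≈0 y≈0 eq = trans (sym (trans (+-congˡ (trans (-‿cong (*-zeroʳ y≈0)) -0#≈0#)) (+-identityʳ _))) eq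

        go : ∀ i j → i ℕ.≤ p → j ℕ.≤ q → hat w i j ≈ 0#
        go zero j _ j≤q = fromℕ-cancel {suc p} (ℕ.s≤s ℕ.z≤n) (first≈0 refl (F≈0 ℕ.z≤n (ℕ.s≤s j≤q)))
        go (suc i) j i<p j≤q = fromℕ-cancel {p ∸ i} (ℕ.m<n⇒0<n∸m i<p) (first≈0
          ([ go i (suc j) (ℕ.<⇒≤ i<p) , (λ { ≡.refl → hat-≥₂ w i ℕ.≤-refl }) ]′ (ℕ.m≤n⇒m<n∨m≡n j≤q))
          (F≈0 (ℕ.m≤n⇒m≤1+n i<p) (ℕ.s≤s j≤q)))

      -- The triangular system solved for the entry at `(i , j)`. Since `ι m` inverts `suc m`, the
      -- inverse of `α (suc i)`, which is `p - i`, is `ι (p ∸ suc i)` for `i < p`.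
      solution : (ℕ → ℕ → Carrier) → ℕ → ℕ → Carrier
      solution f zero    j = ι p * f 0 (suc j)
      solution f (suc i) j = ι (p ∸ suc i) * (f (suc i) (suc j) + β (suc j) * solution f i (suc j))

      θ-solve : V T → V S
      θ-solve u ⟨ i , j ⟩ = solution (hat u) (toℕ i) (toℕ j)

      θ-θ-solve : ∀ u i j → θ p q (θ-solve u) ⟨ inject₁ i , Fin.suc j ⟩ ≈ u ⟨ inject₁ i , Fin.suc j ⟩
      θ-θ-solve u i j = begin
        θ p q w ⟨ inject₁ i , Fin.suc j ⟩
          ≈⟨ θ-hat p q w (inject₁ i) (Fin.suc j) ⟩
        F w (toℕ (inject₁ i)) (suc (toℕ j))
          ≈⟨ go (toℕ (inject₁ i)) (toℕ j)
                (ℕ.≤-trans (ℕ.≤-reflexive (Fin.toℕ-inject₁ i)) (ℕ.≤-pred (Fin.toℕ<n i)))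
                (ℕ.≤-pred (Fin.toℕ<n j)) ⟩
        hat u (toℕ (inject₁ i)) (suc (toℕ j))
          ≈⟨ reflexive (hat-toℕ u (inject₁ i) (Fin.suc j)) ⟩
        u ⟨ inject₁ i , Fin.suc j ⟩ ∎
        where
        w = θ-solve u
        f = solution (hat u)

        w≈ : ∀ {i j} → i ℕ.≤ p → j ℕ.≤ q → hat w i j ≈ f i j
        w≈ = hat-≤ w f (λ _ _ → refl)

        βw≈ : ∀ {i j} → i ℕ.≤ p → j ℕ.≤ suc q → β j * hat w i j ≈ β j * f i j
        βw≈ i≤ j≤ = [ (λ j<1+q → *-congˡ (w≈ i≤ (ℕ.≤-pred j<1+q)))
                    , (λ { ≡.refl → *-zero-congˡ (β-last p q) }) ]′ (ℕ.m≤n⇒m<n∨m≡n j≤)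

        add-sub : ∀ x y → (x + y) - y ≈ x
        add-sub x y = trans (+-assoc _ _ _) (trans (+-congˡ (-‿inverseʳ y)) (+-identityʳ x))

        go : ∀ i j → i ℕ.≤ p → j ℕ.≤ q → F w i (suc j) ≈ hat u i (suc j)
        go zero j _ j≤q = begin
          α 0 * hat w 0 j - β (suc j) * 0#
            ≈⟨ +-cong (*-congˡ (w≈ ℕ.z≤n j≤q)) (trans (-‿cong (zeroʳ _)) -0#≈0#) ⟩
          fromℕᴿ (suc p) * (ι p * hat u 0 (suc j)) + 0#
            ≈⟨ +-identityʳ _ ⟩
          fromℕᴿ (suc p) * (ι p * hat u 0 (suc j))
            ≈⟨ cancel-ι′ p _ ⟩
          hat u 0 (suc j) ∎
        go (suc i) j i<p j≤q = begin
          α (suc i) * hat w (suc i) j - β (suc j) * hat w i (suc j)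
            ≈⟨ +-cong (*-cong (reflexive (cong fromℕᴿ (≡.sym
                                (ℕ.suc-pred (p ∸ i) {{ℕ.>-nonZero (ℕ.m<n⇒0<n∸m i<p)}}))))
                              (w≈ i<p j≤q))
                      (-‿cong (βw≈ (ℕ.<⇒≤ i<p) (ℕ.s≤s j≤q))) ⟩
          fromℕᴿ (suc (ℕ.pred (p ∸ i))) * (ι (p ∸ suc i) * (hat u (suc i) (suc j) + β (suc j) * f i (suc j)))
            - β (suc j) * f i (suc j)
            ≈⟨ +-congʳ (*-congˡ (*-congʳ (reflexive (cong ι (≡.sym (ℕ.pred[m∸n]≡m∸[1+n] p i)))))) ⟩
          fromℕᴿ (suc (ℕ.pred (p ∸ i))) * (ι (ℕ.pred (p ∸ i)) * (hat u (suc i) (suc j) + β (suc j) * f i (suc j)))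
            - β (suc j) * f i (suc j)
            ≈⟨ +-congʳ (cancel-ι′ (ℕ.pred (p ∸ i)) _) ⟩
          (hat u (suc i) (suc j) + β (suc j) * f i (suc j)) - β (suc j) * f i (suc j)
            ≈⟨ add-sub _ _ ⟩
          hat u (suc i) (suc j) ∎

      -- A functional on each rank that vanishes on the image of θ

      mass : ℕ → ℕ → ℕ
      mass i j = (suc p P′ i) ℕ.* (suc q P′ j)

      weight : ℕ → Elt T → ℕ
      weight r ⟨ i , j ⟩ = if does (toℕ i ℕ.+ toℕ j ℕ.≟ r) then mass (toℕ i) (toℕ j) else 0

      weight-yes : ∀ {r} (i : Fin (suc (suc p))) (j : Fin (suc (suc q))) → toℕ i ℕ.+ toℕ j ≡ r →
                   weight r ⟨ i , j ⟩ ≡ mass (toℕ i) (toℕ j)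
      weight-yes {r} i j eq = go (toℕ i ℕ.+ toℕ j ℕ.≟ r)
        where
        go : (d : Dec (toℕ i ℕ.+ toℕ j ≡ r)) → 
           (if does d then mass (toℕ i) (toℕ j) else 0) ≡ mass (toℕ i) (toℕ j)
        go (yes _)  = ≡.refl
        go (no neq) = ⊥-elim (neq eq)

      weight-no : ∀ {r} (i : Fin (suc (suc p))) (j : Fin (suc (suc q))) → toℕ i ℕ.+ toℕ j ≢ r →
                  weight r ⟨ i , j ⟩ ≡ 0
      weight-no {r} i j neq = go (toℕ i ℕ.+ toℕ j ℕ.≟ r)
        where
        go : (d : Dec (toℕ i ℕ.+ toℕ j ≡ r)) → (if does d then mass (toℕ i) (toℕ j) else 0) ≡ 0
        go (yes eq) = ⊥-elim (neq eq)
        go (no _)   = ≡.refl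

      mass>0 : (i : Fin (suc (suc p))) (j : Fin (suc (suc q))) → 0 ℕ.< mass (toℕ i) (toℕ j)
      mass>0 i j = ℕ.*-mono-≤ {1} {suc p P′ toℕ i} {1} {suc q P′ toℕ j}
        (nP′k>0 (ℕ.≤-pred (Fin.toℕ<n i))) (nP′k>0 (ℕ.≤-pred (Fin.toℕ<n j)))

      -- The poset with one element, whose vector space is the scalars; a functional is then an
      -- instance of `extend` and inherits its linearity.
      point : FiniteGradedPoset
      point = M 0 Vector.[]

      weights : ℕ → Elt T → V point
      weights r x _ = fromℕᴿ (weight r x)

      φ : ℕ → V T → Carrier
      φ r u = extend T point (weights r) u tt

      -- If the rank matches `r`, both sides equal `(suc p P′ suc i) * (suc q P′ suc j)`, by the
      -- recursion of the falling factorial; otherwise both are zero.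
      balance : ∀ r (i : Fin (suc p)) (j : Fin (suc q)) →
        (suc p ∸ toℕ i) ℕ.* weight r ⟨ inject₁ i , Fin.suc j ⟩ ≡
        (suc q ∸ suc (toℕ j) ℕ.+ 1) ℕ.* weight r ⟨ Fin.suc i , inject₁ j ⟩
      balance r i j = go (toℕ i ℕ.+ suc (toℕ j) ℕ.≟ r)
        where
        rank≡ : toℕ (inject₁ i) ℕ.+ suc (toℕ j) ≡ toℕ i ℕ.+ suc (toℕ j)
        rank≡ = cong (ℕ._+ suc (toℕ j)) (Fin.toℕ-inject₁ i)

        rank≡′ : suc (toℕ i) ℕ.+ toℕ (inject₁ j) ≡ toℕ i ℕ.+ suc (toℕ j)
        rank≡′ = ≡.trans (cong (suc (toℕ i) ℕ.+_) (Fin.toℕ-inject₁ j)) (≡.sym (ℕ.+-suc (toℕ i) (toℕ j)))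

        swap : ∀ a b x y → a ℕ.* (x ℕ.* (b ℕ.* y)) ≡ b ℕ.* (a ℕ.* x ℕ.* y)
        swap = ℕ.solve-∀

        go : Dec (toℕ i ℕ.+ suc (toℕ j) ≡ r) →
          (suc p ∸ toℕ i) ℕ.* weight r ⟨ inject₁ i , Fin.suc j ⟩ ≡
          (suc q ∸ suc (toℕ j) ℕ.+ 1) ℕ.* weight r ⟨ Fin.suc i , inject₁ j ⟩
        go (no neq) = ≡.trans
          (≡.trans (cong ((suc p ∸ toℕ i) ℕ.*_) (weight-no (inject₁ i) (Fin.suc j) 
                                               (neq ∘ ≡.trans (≡.sym rank≡))))
                   (ℕ.*-zeroʳ (suc p ∸ toℕ i)))
          (≡.sym (≡.trans (cong ((suc q ∸ suc (toℕ j) ℕ.+ 1) ℕ.*_)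
                            (weight-no (Fin.suc i) (inject₁ j) (neq ∘ ≡.trans (≡.sym rank≡′))))
                          (ℕ.*-zeroʳ (suc q ∸ suc (toℕ j) ℕ.+ 1))))
        go (yes eq) = ≡.trans
          (cong ((suc p ∸ toℕ i) ℕ.*_) (≡.trans (weight-yes (inject₁ i) (Fin.suc j) (≡.trans rank≡ eq))
            (cong (λ m → mass m (suc (toℕ j))) (Fin.toℕ-inject₁ i))))
          (≡.trans (swap (suc p ∸ toℕ i) (suc q ∸ toℕ j) (suc p P′ toℕ i) (suc q P′ toℕ j))
            (cong₂ ℕ._*_ (≡.sym (1+q∸j p q j)) (≡.sym (≡.trans
              (weight-yes (Fin.suc i) (inject₁ j) (≡.trans rank≡′ eq))
              (cong (mass (suc (toℕ i))) (Fin.toℕ-inject₁ j))))))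

      -- After exchanging the sums it suffices to treat one `θ-image` vector. It has two terms, and
      -- their weighted coefficients cancel by `balance`.
      φ-θ : ∀ r w → φ r (θ p q w) ≈ 0#
      φ-θ r w = begin
        φ r (θ p q w)
          ≈⟨ extend-∑ T point (weights r) (θ p q w) tt ⟩
        ∑ els (λ x → θ p q w x * g x)
          ≈⟨ ∑-cong els (λ x → trans (*-congʳ (extend-∑ S T (θ-image p q) w x))
               (*-distribʳ-∑ els′ (g x) (λ y → w y * θ-image p q y x))) ⟩
        ∑ els (λ x → ∑ els′ (λ y → w y * θ-image p q y x * g x))
          ≈⟨ ∑-comm els els′ (λ x y → w y * θ-image p q y x * g x) ⟩
        ∑ els′ (λ y → ∑ els (λ x → w y * θ-image p q y x * g x))
          ≈⟨ ∑-zero els′ (λ y → trans (∑-cong els (λ x → *-assoc _ _ _)) (trans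
               (sym (*-distribˡ-∑ els (w y) (λ x → θ-image p q y x * g x)))
               (*-zeroʳ (orthogonal y)))) ⟩
        0# ∎
        where
        els  = elements T
        els′ = elements S

        g : Elt T → Carrier
        g x = fromℕᴿ (weight r x)

        pick : ∀ a y → ∑ els (λ x → a * δ T y x * g x) ≈ a * g y
        pick a y = trans
          (∑-elements-single T y λ x x≢y → *-zeroˡ (*-zeroʳ (ind-no (_≟_ T y x) (x≢y ∘ ≡.sym))))
          (*-congʳ (*-oneʳ (ind-yes (_≟_ T y y) ≡.refl)))

        orthogonal : ∀ y → ∑ els (λ x → θ-image p q y x * g x) ≈ 0#
        orthogonal y@(⟨ i , j ⟩) = begin
          ∑ els (λ x → θ-image p q y x * g x)
            ≈⟨ ∑-cong els (λ x → trans (distribʳ _ _ _) (+-congˡ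
                 (trans (sym (-‿distribˡ-* _ _)) (sym (-1*x≈-x _))))) ⟩
          ∑ els (λ x → a * δ T y₁ x * g x + - 1# * (b * δ T y₂ x * g x))
            ≈⟨ ∑-+ els (λ x → a * δ T y₁ x * g x) (λ x → - 1# * (b * δ T y₂ x * g x)) ⟩
          ∑ els (λ x → a * δ T y₁ x * g x) + ∑ els (λ x → - 1# * (b * δ T y₂ x * g x))
            ≈⟨ +-cong (pick a y₁) (trans (sym (*-distribˡ-∑ els (- 1#) (λ x → b * δ T y₂ x * g x)))
                 (trans (*-congˡ (pick b y₂)) (-1*x≈-x _))) ⟩
          a * g y₁ - b * g y₂
            ≈⟨ +-cong (fromℕ-* (suc p ∸ toℕ i) (weight r y₁))
                 (-‿cong (fromℕ-* (suc q ∸ suc (toℕ j) ℕ.+ 1) (weight r y₂))) ⟨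
          fromℕᴿ ((suc p ∸ toℕ i) ℕ.* weight r y₁) - fromℕᴿ ((suc q ∸ suc (toℕ j) ℕ.+ 1) ℕ.* weight r y₂)
            ≈⟨ +-congʳ (reflexive (cong fromℕᴿ (balance r i j))) ⟩
          fromℕᴿ ((suc q ∸ suc (toℕ j) ℕ.+ 1) ℕ.* weight r y₂)
            - fromℕᴿ ((suc q ∸ suc (toℕ j) ℕ.+ 1) ℕ.* weight r y₂)
            ≈⟨ -‿inverseʳ _ ⟩
          0# ∎
          where
          a = fromℕᴿ (suc p ∸ toℕ i)
          b = fromℕᴿ (suc q ∸ suc (toℕ j) ℕ.+ 1)

          y₁ y₂ : Elt T
          y₁ = ⟨ inject₁ i , Fin.suc j ⟩
          y₂ = ⟨ Fin.suc i , inject₁ j ⟩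

      φ-binomial-≢ : ∀ {r k} → k ≢ r → φ r (binomialVector p q k) ≈ 0#
      φ-binomial-≢ {r} {k} k≢r = trans (extend-∑ T point (weights r) (binomialVector p q k) tt)
        (∑-zero (elements T) term)
        where
        term : ∀ x → binomialVector p q k x * fromℕᴿ (weight r x) ≈ 0#
        term ⟨ i , j ⟩ = go (toℕ i ℕ.+ toℕ j ℕ.≟ r)
          where
          go : Dec (toℕ i ℕ.+ toℕ j ≡ r) → binomialVector p q k ⟨ i , j ⟩ * fromℕᴿ (weight r ⟨ i , j ⟩) ≈ 0#
          go (yes eq) = *-zeroˡ (binomial-rank p q k ⟨ i , j ⟩ (λ eq′ → k≢r (≡.trans (≡.sym eq′) eq)))
          go (no neq) = *-zeroʳ (reflexive (cong fromℕᴿ (weight-no i j neq)))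

      -- The witness is the corner of rank `r`: on the edge `j = 0` while `r ≤ suc p`, then on the
      -- edge `i = suc p`.
      inBox : ∀ {r} → r ℕ.≤ suc p ℕ.+ suc q → ∃ λ (x : Elt T) → rank T x ≡ r
      inBox {r} r≤ with r ℕ.≤? suc p
      ... | yes r≤p = ⟨ Fin.fromℕ< (ℕ.s≤s r≤p) , Fin.zero ⟩ ,
                      ≡.trans (ℕ.+-identityʳ _) (Fin.toℕ-fromℕ< (ℕ.s≤s r≤p))
      ... | no r≰p = ⟨ fromℕ (suc p) , Fin.fromℕ< (ℕ.s≤s r∸p≤q) ⟩ ,
                     ≡.trans (cong₂ ℕ._+_ (Fin.toℕ-fromℕ (suc p)) (Fin.toℕ-fromℕ< (ℕ.s≤s r∸p≤q)))
                             (ℕ.m+[n∸m]≡n (ℕ.<⇒≤ (ℕ.≰⇒> r≰p)))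
        where
        r∸p≤q : r ∸ suc p ℕ.≤ suc q
        r∸p≤q = ℕ.m≤n+o⇒m∸n≤o r (suc p) r≤

      -- The value is a sum of natural numbers, with a positive summand at each element of rank `r`.
      -- The form `suc m` makes it invertible through `ι m`.
      φ-binomial-≡ : ∀ r → r ℕ.≤ suc p ℕ.+ suc q → ∃ λ m → φ r (binomialVector p q r) ≈ fromℕᴿ (suc m)
      φ-binomial-≡ r r≤ = positive (inBox r≤)
        where
        h : Elt T → ℕ
        h ⟨ i , j ⟩ = (if does (toℕ i ℕ.+ toℕ j ℕ.≟ r) then r C toℕ i else 0) ℕ.* weight r ⟨ i , j ⟩

        h≈ : ∀ x → binomialVector p q r x * fromℕᴿ (weight r x) ≈ fromℕᴿ (h x)
        h≈ ⟨ i , j ⟩ = trans (*-congʳ (if-fromℕ (does (toℕ i ℕ.+ toℕ j ℕ.≟ r)) (r C toℕ i)))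
          (sym (fromℕ-* (if does (toℕ i ℕ.+ toℕ j ℕ.≟ r) then r C toℕ i else 0) (weight r ⟨ i , j ⟩)))
          where
          if-fromℕ : ∀ b m → (if b then fromℕᴿ m else 0#) ≈ fromℕᴿ (if b then m else 0)
          if-fromℕ true  _ = refl
          if-fromℕ false _ = refl

        h>0 : ∀ x → rank T x ≡ r → 0 ℕ.< h x
        h>0 ⟨ i , j ⟩ eq = ℕ.*-mono-≤ {1} {_} {1} (go (toℕ i ℕ.+ toℕ j ℕ.≟ r))
          (ℕ.≤-trans (mass>0 i j) (ℕ.≤-reflexive (≡.sym (weight-yes i j eq))))
          where
          go : (d : Dec (toℕ i ℕ.+ toℕ j ≡ r)) → 0 ℕ.< (if does d then r C toℕ i else 0)
          go (yes _)  = nCk>0 (ℕ.≤-trans (ℕ.m≤m+n (toℕ i) (toℕ j)) (ℕ.≤-reflexive eq))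
          go (no neq) = ⊥-elim (neq eq)

        positive : ∃ (λ x → rank T x ≡ r) → ∃ λ m → φ r (binomialVector p q r) ≈ fromℕᴿ (suc m)
        positive (x , ∣x∣≡r) = ℕ.pred (sumℕ (map h (elements T))) , (begin
          φ r (binomialVector p q r)
            ≈⟨ extend-∑ T point (weights r) (binomialVector p q r) tt ⟩
          ∑ (elements T) (λ x → binomialVector p q r x * fromℕᴿ (weight r x))
            ≈⟨ ∑-cong (elements T) h≈ ⟩
          ∑ (elements T) (λ x → fromℕᴿ (h x))
            ≈⟨ ∑-fromℕ (elements T) h ⟩
          fromℕᴿ (sumℕ (map h (elements T)))
            ≡⟨ cong fromℕᴿ (ℕ.suc-pred _ {{ℕ.>-nonZero (sum-positive h (complete T x) (h>0 x ∣x∣≡r))}}) ⟨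
          fromℕᴿ (suc (ℕ.pred (sumℕ (map h (elements T))))) ∎)

      -- V(M(2,p+1,q+1)) is the direct sum of the binomial chain and the image of θ

      φ-chainSum : ∀ x (r : Fin (suc (suc p ℕ.+ suc q))) →
        φ (toℕ r) (chainSum (binomialSeq p q) x) ≈ x r * φ (toℕ r) (binomialVector p q (toℕ r))
      φ-chainSum x r = trans
        (extend-sum T point (weights (toℕ r)) x (λ k → binomialVector p q (toℕ k)) tt)
        (sum-single {f = λ k → x k * φ (toℕ r) (binomialVector p q (toℕ k))} r
          λ k k≢r → *-zeroʳ (φ-binomial-≢ (k≢r ∘ Fin.toℕ-injective)))

      -- Under the hypothesis only the term at `x₀` survives in the functional, and its weight is a
      -- positive integer.
      φ-weight-zero : ∀ u x₀ → (∀ x → x ≢ x₀ → rank T x ≡ rank T x₀ → u x ≈ 0#) →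
                      φ (rank T x₀) u ≈ 0# → u x₀ ≈ 0#
      φ-weight-zero u x₀@(⟨ i₀ , j₀ ⟩) u≈0 φu≈0 = fromℕ-cancel (mass>0 i₀ j₀) (begin
        fromℕᴿ (mass (toℕ i₀) (toℕ j₀)) * u x₀
          ≈⟨ *-comm _ _ ⟩
        u x₀ * fromℕᴿ (mass (toℕ i₀) (toℕ j₀))
          ≡⟨ cong (λ m → u x₀ * fromℕᴿ m) (weight-yes i₀ j₀ ≡.refl) ⟨
        u x₀ * fromℕᴿ (weight r x₀)
          ≈⟨ ∑-elements-single T x₀ others ⟨
        ∑ (elements T) (λ x → u x * fromℕᴿ (weight r x))
          ≈⟨ extend-∑ T point (weights r) u tt ⟨
        φ r u
          ≈⟨ φu≈0 ⟩
        0# ∎)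
        where
        r = rank T x₀

        others : ∀ x → x ≢ x₀ → u x * fromℕᴿ (weight r x) ≈ 0#
        others ⟨ i , j ⟩ x≢x₀ = go (toℕ i ℕ.+ toℕ j ℕ.≟ r)
          where
          go : Dec (toℕ i ℕ.+ toℕ j ≡ r) → u ⟨ i , j ⟩ * fromℕᴿ (weight r ⟨ i , j ⟩) ≈ 0#
          go (yes eq) = *-zeroˡ (u≈0 ⟨ i , j ⟩ x≢x₀ eq)
          go (no neq) = *-zeroʳ (reflexive (cong fromℕᴿ (weight-no i j neq)))

      -- Each rank has exactly one corner.
      data Position : Elt T → Set where
        interior : ∀ i j → Position ⟨ inject₁ i , Fin.suc j ⟩
        corner   : ∀ {i j} → toℕ j ≡ 0 ⊎ toℕ i ≡ suc p → Position ⟨ i , j ⟩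

      position : ∀ x → Position x
      position ⟨ i , Fin.zero ⟩ = corner (inj₁ ≡.refl)
      position ⟨ i , Fin.suc j ⟩ = go (view i)
        where
        go : ∀ {i : Fin (suc (suc p))} → Top.View i → Position ⟨ i , Fin.suc j ⟩
        go ‵fromℕ       = corner (inj₂ (Fin.toℕ-fromℕ (suc p)))
        go (‵inject₁ i) = interior i j

      ≋0-from-interior : ∀ u → (∀ i j → u ⟨ inject₁ i , Fin.suc j ⟩ ≈ 0#) →
        (∀ r → r ℕ.≤ suc p ℕ.+ suc q → φ r u ≈ 0#) → ∀ x → u x ≈ 0#
      ≋0-from-interior u interior≈0 φu≈0 x₀ = go (position x₀)
        where
        go : ∀ {x} → Position x → u x ≈ 0#
        go (interior i j) = interior≈0 i j
        go {⟨ i₀ , j₀ ⟩} (corner c₀) = φ-weight-zero u ⟨ i₀ , j₀ ⟩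
          (λ x x≢x₀ r≡ → others (position x) x≢x₀ r≡)
          (φu≈0 (toℕ i₀ ℕ.+ toℕ j₀) (ℕ.+-mono-≤ (ℕ.≤-pred (Fin.toℕ<n i₀)) (ℕ.≤-pred (Fin.toℕ<n j₀))))
          where
          others : ∀ {x} → Position x → x ≢ ⟨ i₀ , j₀ ⟩ → rank T x ≡ toℕ i₀ ℕ.+ toℕ j₀ → u x ≈ 0#
          others (interior i j) _ _ = interior≈0 i j
          others {⟨ i , j ⟩} (corner c) x≢x₀ r≡ =
            let i≡ , j≡ = corner-unique (ℕ.≤-pred (Fin.toℕ<n i)) (ℕ.≤-pred (Fin.toℕ<n i₀)) r≡ c c₀
            in ⊥-elim (x≢x₀ (cong₂ (λ i j → ⟨ i , j ⟩) (Fin.toℕ-injective i≡) (Fin.toℕ-injective j≡)))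

    add-sub : ∀ x y → x + (y + - 1# * x) ≈ y
    add-sub x y = begin
      x + (y + - 1# * x)   ≈⟨ +-congˡ (+-congˡ (-1*x≈-x x)) ⟩
      x + (y + - x)        ≈⟨ +-congˡ (+-comm _ _) ⟩
      x + (- x + y)        ≈⟨ +-assoc _ _ _ ⟨
      (x + - x) + y        ≈⟨ +-congʳ (-‿inverseʳ x) ⟩
      0# + y               ≈⟨ +-identityˡ y ⟩
      y                    ∎

    sub-self : ∀ {x y} → x ≈ y → x + - 1# * y ≈ 0#
    sub-self x≈y = trans (+-cong x≈y (-1*x≈-x _)) (-‿inverseʳ _)

    module _ (p q : ℕ) {𝓢 : List (Seq (V (M₂ p q)))} (basis : Basis 𝓢) where

      private
        S = M₂ p q
        T = M₂ (suc p) (suc q)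
        N = suc p ℕ.+ suc q

        module B = Basis basis

        F : V S → V T
        F = θ p q

        φ′ : ℕ → V T → Carrier
        φ′ = φ p q

        chainSum′ : Vector Carrier (suc N) → V T
        chainSum′ = chainSum (binomialSeq p q)

        φ-+ : ∀ r u v → φ′ r (λ t → u t + v t) ≈ φ′ r u + φ′ r v
        φ-+ r u v = extend-+ T (point p q) (weights p q r) u v tt

        φ-* : ∀ r y v → φ′ r (λ t → y * v t) ≈ y * φ′ r v
        φ-* r y v = extend-* T (point p q) (weights p q r) y v tt

        module _ (r : Fin (suc N)) where

          norm : ℕ
          norm = proj₁ (φ-binomial-≡ p q (toℕ r) (ℕ.≤-pred (Fin.toℕ<n r)))

          φ-chainSum′ : ∀ x → φ′ (toℕ r) (chainSum′ x) ≈ fromℕᴿ (suc norm) * x r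
          φ-chainSum′ x = trans (φ-chainSum p q x r) (trans
            (*-congˡ (proj₂ (φ-binomial-≡ p q (toℕ r) (ℕ.≤-pred (Fin.toℕ<n r))))) (*-comm _ _))

      binomial-∷-basis : Basis (binomialSeq p q ∷ map (mapSeq (θ p q)) 𝓢)
      binomial-∷-basis = record { independent = indep ; spanning = span }
        where
        indep : ∀ x → (∀ t → lin (binomialSeq p q ∷ map (mapSeq F) 𝓢) x t ≈ 0#) →
                Null (binomialSeq p q ∷ map (mapSeq F) 𝓢) x
        indep (x , c) lin≈0 = x≈0 , unmapCoef-null F 𝓢 c
          (B.independent (unmapCoef F 𝓢 c) (θ-injective p q w θw≈0))
          where
          w : V S
          w = lin 𝓢 (unmapCoef F 𝓢 c)

          total≈0 : ∀ t → chainSum′ x t + F w t ≈ 0#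
          total≈0 t = trans (+-congˡ (sym (lin-map S T (θ-image p q) 𝓢 c t))) (lin≈0 t)

          -- The functional of rank `r` kills the θ part and every binomial vector except the one of
          -- rank `r`, which isolates `x r`.
          x≈0 : ∀ r → x r ≈ 0#
          x≈0 r = fromℕ-cancel {suc (norm r)} (ℕ.s≤s ℕ.z≤n) (begin
            fromℕᴿ (suc (norm r)) * x r
              ≈⟨ φ-chainSum′ r x ⟨
            φ′ (toℕ r) (chainSum′ x)
              ≈⟨ trans (+-congˡ (φ-θ p q (toℕ r) w)) (+-identityʳ _) ⟨
            φ′ (toℕ r) (chainSum′ x) + φ′ (toℕ r) (F w)
              ≈⟨ φ-+ (toℕ r) (chainSum′ x) (F w) ⟨
            φ′ (toℕ r) (λ t → chainSum′ x t + F w t)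
              ≈⟨ extend-zero T (point p q) (weights p q (toℕ r)) total≈0 tt ⟩
            0# ∎)

          θw≈0 : ∀ t → F w t ≈ 0#
          θw≈0 t = begin
            F w t                   ≈⟨ +-identityˡ _ ⟨
            0# + F w t              ≈⟨ +-congʳ (sum-zero {f = λ k → x k * binomialVector p q (toℕ k) t}
                                         (λ k → *-zeroˡ (x≈0 k))) ⟨
            chainSum′ x t + F w t   ≈⟨ total≈0 t ⟩
            0#                      ∎

        span : ∀ (v : V T) → ∃ λ x → ∀ t → lin (binomialSeq p q ∷ map (mapSeq F) 𝓢) x t ≈ v t
        span v = (x , mapCoef F 𝓢 (proj₁ (B.spanning w))) , λ t → begin
          chainSum′ x t + lin (map (mapSeq F) 𝓢) (mapCoef F 𝓢 (proj₁ (B.spanning w))) t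
            ≈⟨ +-congˡ (extend-lin S T (θ-image p q) 𝓢 (proj₁ (B.spanning w)) t) ⟨
          chainSum′ x t + F (lin 𝓢 (proj₁ (B.spanning w))) t
            ≈⟨ +-congˡ (extend-cong S T (θ-image p q) {lin 𝓢 (proj₁ (B.spanning w))} {w}
                 (proj₂ (B.spanning w)) t) ⟩
          chainSum′ x t + F w t
            ≈⟨ +-congˡ (trans (sym (+-identityʳ _)) (trans (+-congˡ (sym (y≈0 t))) (add-sub (F w t) (u t)))) ⟩
          chainSum′ x t + u t
            ≈⟨ add-sub (chainSum′ x t) (v t) ⟩
          v t ∎
          where
          x : Vector Carrier (suc N)
          -- Chosen so that every functional vanishes on the remainder `u`: `suc (norm r)` is the
          -- value of the functional at the binomial vector of rank `r`.
          x r = ι (norm r) * φ′ (toℕ r) v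

          u : V T
          u t = v t + - 1# * chainSum′ x t

          w : V S
          w = θ-solve p q u

          -- The error of the partial solution `w`. It is zero at interior positions and is killed
          -- by every functional, hence is zero at the corners too.
          y : V T
          y t = u t + - 1# * F w t

          φu≈0 : ∀ r → r ℕ.≤ N → φ′ r u ≈ 0#
          φu≈0 r r≤ = subst (λ r → φ′ r u ≈ 0#) (Fin.toℕ-fromℕ< (ℕ.s≤s r≤)) (go (Fin.fromℕ< (ℕ.s≤s r≤)))
            where
            go : ∀ (r : Fin (suc N)) → φ′ (toℕ r) u ≈ 0#
            go r = begin
              φ′ (toℕ r) u
                ≈⟨ φ-+ (toℕ r) v (λ t → - 1# * chainSum′ x t) ⟩
              φ′ (toℕ r) v + φ′ (toℕ r) (λ t → - 1# * chainSum′ x t)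
                ≈⟨ +-congˡ (φ-* (toℕ r) (- 1#) (chainSum′ x)) ⟩
              φ′ (toℕ r) v + - 1# * φ′ (toℕ r) (chainSum′ x)
                ≈⟨ sub-self (sym (trans (φ-chainSum′ r x) (cancel-ι′ (norm r) _))) ⟩
              0# ∎

          y≈0 : ∀ t → y t ≈ 0#
          y≈0 = ≋0-from-interior p q y (λ i j → sub-self (sym (θ-θ-solve p q u i j))) λ r r≤ → begin
            φ′ r y                              ≈⟨ φ-+ r u (λ t → - 1# * F w t) ⟩
            φ′ r u + φ′ r (λ t → - 1# * F w t)  ≈⟨ +-cong (φu≈0 r r≤) (φ-* r (- 1#) (F w)) ⟩
            0# + - 1# * φ′ r (F w)              ≈⟨ +-zero refl (*-zeroʳ (φ-θ p q r w)) ⟩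
            0#                                  ∎

    𝓙-basis : ∀ p q → Basis (𝓙 p q)
    𝓙-basis zero    q       = basis-standard (M₂ 0 q) (λ j → ⟨ Fin.zero , j ⟩) (λ _ → ≡.refl)
      (λ { ⟨ Fin.zero , j ⟩ → j , ≡.refl })
      (λ v j → trans (U-M₂ 0 q v Fin.zero j) (+-identityˡ _))
    𝓙-basis (suc p) zero    = basis-standard (M₂ (suc p) 0) (λ i → ⟨ i , Fin.zero ⟩)
      (λ i → ℕ.+-identityʳ (toℕ i)) (λ { ⟨ i , Fin.zero ⟩ → i , ≡.refl })
      (λ v i → trans (U-M₂ (suc p) 0 v i Fin.zero) (+-identityʳ _))
    𝓙-basis (suc p) (suc q) = binomial-∷-basis p q (𝓙-basis p q)

    -- The map ψ

    module _ (n : ℕ) (k : Vector ℕ (suc n)) where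

      private
        P = M n (init k)
        Q = M (suc n) k
        K = last k

      append-formula : ∀ j u a j′ → append n k j u (a , j′) ≈ u a * ind (j Fin.≟ j′)
      append-formula j u a j′ = trans (extend-∑ P Q (λ b → δ Q (b , j)) u (a , j′)) (go (j Fin.≟ j′))
        where
        go : (d : Dec (j ≡ j′)) → ∑ (elements P) (λ b → u b * δ Q (b , j) (a , j′)) ≈ u a * ind d
        go (yes ≡.refl) = trans
          (∑-elements-single P a λ b b≢a → *-zeroʳ (ind-no (_≟_ Q (b , j) (a , j)) (b≢a ∘ cong proj₁)))
          (*-congˡ (ind-yes (_≟_ Q (a , j) (a , j)) ≡.refl))
        go (no j≢j′) = trans
          (∑-zero (elements P) λ b → *-zeroʳ (ind-no (_≟_ Q (b , j) (a , j′)) (j≢j′ ∘ cong proj₂)))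
          (sym (zeroʳ _))

      module _ (s : Seq (V P)) where

        private
          l = proj₁ s
          v = proj₂ s
          W = M₂ l K

        -- The anonymous function in the definition of ψ.
        ψ-image : Elt W → V Q
        ψ-image ⟨ i , j ⟩ = append n k j (v i)

        ψ-formula : ∀ w a j → ψ n k s w (a , j) ≈ chainSum s (λ i → w ⟨ i , j ⟩) a
        ψ-formula w a j = begin
          ψ n k s w (a , j)
            ≈⟨ extend-∑ W Q ψ-image w (a , j) ⟩
          ∑ (elements W) (λ x → w x * ψ-image x (a , j))
            ≈⟨ ∑-elements-M₂ l K (λ x → w x * ψ-image x (a , j)) ⟩
          sum (λ i → sum (λ j′ → w ⟨ i , j′ ⟩ * append n k j′ (v i) (a , j)))
            ≈⟨ sum-cong-≋ (λ i → sum-single {f = λ j′ → w ⟨ i , j′ ⟩ * append n k j′ (v i) (a , j)} j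
                 λ j′ j′≢j → *-zeroʳ (trans (append-formula j′ (v i) a j) (*-zeroʳ (ind-no (j′ Fin.≟ j) j′≢j)))) ⟩
          sum (λ i → w ⟨ i , j ⟩ * append n k j (v i) (a , j))
            ≈⟨ sum-cong-≋ {x = λ i → w ⟨ i , j ⟩ * append n k j (v i) (a , j)} {y = λ i → w ⟨ i , j ⟩ * v i a}
                 (λ i → *-congˡ (trans (append-formula j (v i) a j) (*-oneʳ (ind-yes (j Fin.≟ j) ≡.refl)))) ⟩
          chainSum s (λ i → w ⟨ i , j ⟩) a ∎

    -- The function whose linear extension is `U P`; naming it makes the linearity lemmas for
    -- `extend` applicable to `U`.
    covers : ∀ P → Elt P → V P
    covers P p q = sumOver (filter (_⋖?_ P p) (elements P)) (λ q′ → δ P q′ q)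

    module _ (n : ℕ) (k : Vector ℕ (suc n)) where

      private
        P = M n (init k)
        Q = M (suc n) k
        K = last k

      module _ {d} (s : Seq (V P)) (ch : Chain P d s) where

        private
          l = proj₁ s
          v = proj₂ s
          W = M₂ l K
          module C = Chain ch

        -- By `U-suc`, `U` raises either the part in `P` or the last coordinate. On the chain `v`
        -- the former shifts the index `i`, so both act on the coefficients `w` exactly as in
        -- `U-M₂`.
        U-ψ : ∀ w → _≋_ Q (U Q (ψ n k s w)) (ψ n k s (U W w))
        U-ψ w (a , j) = begin
          U Q (ψ n k s w) (a , j)
            ≈⟨ U-suc n k (ψ n k s w) a j ⟩
          U P (λ b → ψ n k s w (b , j)) a + below (λ j → ψ n k s w (a , j)) j
            ≈⟨ +-cong up (across j) ⟩
          sum (λ i → below (λ i → w ⟨ i , j ⟩) i * v i a) + sum (λ i → below (λ j → w ⟨ i , j ⟩) j * v i a)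
            ≈⟨ ∑-distrib-+ (λ i → below (λ i → w ⟨ i , j ⟩) i * v i a)
                           (λ i → below (λ j → w ⟨ i , j ⟩) j * v i a) ⟨
          sum (λ i → below (λ i → w ⟨ i , j ⟩) i * v i a + below (λ j → w ⟨ i , j ⟩) j * v i a)
            ≈⟨ sum-cong-≋ {x = λ i → below (λ i → w ⟨ i , j ⟩) i * v i a + below (λ j → w ⟨ i , j ⟩) j * v i a}
                 {y = λ i → U W w ⟨ i , j ⟩ * v i a}
                 (λ i → trans (sym (distribʳ _ _ _)) (*-congʳ (sym (U-M₂ l K w i j)))) ⟩
          sum (λ i → U W w ⟨ i , j ⟩ * v i a)
            ≈⟨ ψ-formula n k s (U W w) a j ⟨
          ψ n k s (U W w) (a , j) ∎
          where
          up : U P (λ b → ψ n k s w (b , j)) a ≈ sum (λ i → below (λ i → w ⟨ i , j ⟩) i * v i a)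
          up = begin
            U P (λ b → ψ n k s w (b , j)) a
              ≈⟨ extend-cong P P (covers P) (λ b → ψ-formula n k s w b j) a ⟩
            U P (chainSum s (λ i → w ⟨ i , j ⟩)) a
              ≈⟨ extend-sum P P (covers P) (λ i → w ⟨ i , j ⟩) v a ⟩
            sum (λ i → w ⟨ i , j ⟩ * U P (v i) a)
              -- The last vector is split off because `U` kills it; for the others `U` moves index
              -- `inject₁ i` to `Fin.suc i`, and a zero term at index zero completes the shifted
              -- sum.
              ≈⟨ sum-init-last (λ i → w ⟨ i , j ⟩ * U P (v i) a) ⟩
            sum (λ i → w ⟨ inject₁ i , j ⟩ * U P (v (inject₁ i)) a) + w ⟨ fromℕ l , j ⟩ * U P (v (fromℕ l)) a
              ≈⟨ +-cong (sum-cong-≋ {x = λ i → w ⟨ inject₁ i , j ⟩ * U P (v (inject₁ i)) a}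
                           {y = λ i → w ⟨ inject₁ i , j ⟩ * v (Fin.suc i) a} (λ i → *-congˡ (C.step i a)))
                        (*-zeroʳ (C.end a)) ⟩
            sum (λ i → w ⟨ inject₁ i , j ⟩ * v (Fin.suc i) a) + 0#
              ≈⟨ +-comm _ _ ⟩
            0# + sum (λ i → w ⟨ inject₁ i , j ⟩ * v (Fin.suc i) a)
              ≈⟨ +-congʳ (zeroˡ (v Fin.zero a)) ⟨
            sum (λ i → below (λ i → w ⟨ i , j ⟩) i * v i a) ∎

          across : ∀ j → below (λ j → ψ n k s w (a , j)) j ≈ sum (λ i → below (λ j → w ⟨ i , j ⟩) j * v i a)
          across Fin.zero    = sym (sum-zero {f = λ i → 0# * v i a} λ i → zeroˡ (v i a))
          across (Fin.suc j) = ψ-formula n k s w a (inject₁ j)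

        ψ-image-rank : ∀ x → HasRank Q (ψ-image n k s x) (C.bottom ℕ.+ rank W x)
        ψ-image-rank ⟨ i , j ⟩ (a , j′) r≢ = trans (append-formula n k j (v i) a j′) (go (j Fin.≟ j′))
          where
          go : (d : Dec (j ≡ j′)) → v i a * ind d ≈ 0#
          go (yes ≡.refl) = *-zeroˡ (C.ranks i a λ r≡ → r≢
            (≡.trans (cong (ℕ._+ toℕ j) r≡) (ℕ.+-assoc C.bottom (toℕ i) (toℕ j))))
          go (no _) = zeroʳ _

        -- Bottom ranks add. With bottoms `b`, `b′` the end ranks sum to `2b + (2b′ + h)`, which is
        -- `2b + l + K` by symmetry of `t`, and so `d + K` by symmetry of `s`.
        ψ-chain : ∀ {t} → Chain W (l ℕ.+ K) t → Chain Q (d ℕ.+ K) (mapSeq (ψ n k s) t)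
        ψ-chain {h , w} ch′ = record
          { bottom    = C.bottom ℕ.+ D.bottom
          ; ranks     = λ i → subst (HasRank Q (ψ n k s (w i))) (≡.sym (ℕ.+-assoc C.bottom D.bottom (toℕ i)))
              (extend-rank W Q (ψ-image n k s) C.bottom ψ-image-rank (D.ranks i))
          ; symmetric = ≡.trans (interchange C.bottom D.bottom h)
              (≡.trans (cong (C.bottom ℕ.+ C.bottom ℕ.+_) D.symmetric)
                (≡.trans (reassociate C.bottom l K) (cong (ℕ._+ K) C.symmetric)))
          ; step      = λ i x → trans (U-ψ (w (inject₁ i)) x) (extend-cong W Q (ψ-image n k s) (D.step i) x)
          ; end       = λ x → trans (U-ψ (w (fromℕ h)) x) (extend-zero W Q (ψ-image n k s) D.end x)
          }
          where
          module D = Chain ch′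

          interchange : ∀ b b′ h → b ℕ.+ b′ ℕ.+ (b ℕ.+ b′ ℕ.+ h) ≡ b ℕ.+ b ℕ.+ (b′ ℕ.+ (b′ ℕ.+ h))
          interchange = ℕ.solve-∀

          reassociate : ∀ b l m → b ℕ.+ b ℕ.+ (l ℕ.+ m) ≡ b ℕ.+ (b ℕ.+ l) ℕ.+ m
          reassociate = ℕ.solve-∀

      ψ-integral : ∀ s → IsIntegralSeq P s → ∀ {w} → IsIntegral (M₂ (proj₁ s) K) w → IsIntegral Q (ψ n k s w)
      ψ-integral s@(l , v) vℤ {w} wℤ = integral-extend (M₂ l K) Q (ψ-image n k s) w
        (λ ((_ , i) , j) → integral-extend P Q (λ b → δ Q (b , j)) (v i)
          (λ b x → integral-ind (_≟_ Q (b , j) x)) (vℤ i))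
        wℤ

      products : Seq (V P) → List (Seq (V Q))
      products s = map (mapSeq (ψ n k s)) (𝓙 (proj₁ s) K)

      module _ (s : Seq (V P)) where

        private
          l = proj₁ s
          W = M₂ l K

        lin-products : ∀ x a j → lin (products s) x (a , j) ≈
          chainSum s (λ i → lin (𝓙 l K) (unmapCoef (ψ n k s) (𝓙 l K) x) ⟨ i , j ⟩) a
        lin-products x a j = trans (lin-map W Q (ψ-image n k s) (𝓙 l K) x (a , j))
          (ψ-formula n k s (lin (𝓙 l K) (unmapCoef (ψ n k s) (𝓙 l K) x)) a j)

      -- The coordinates with respect to `𝓢` of the slice at last coordinate `j`. Those belonging to
      -- `s` form row `j` of the vector of `M₂ l K` that the coefficients of `products s` describe.
      slice : ∀ 𝓢 → Coef (concatMap products 𝓢) → Fin (suc K) → Coef 𝓢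
      slice []      _ j = _
      slice (s ∷ 𝓢) x j =
          (λ i → lin (𝓙 (proj₁ s) K) (unmapCoef (ψ n k s) (𝓙 (proj₁ s) K)
                   (proj₁ (splitCoef (products s) (concatMap products 𝓢) x))) ⟨ i , j ⟩)
        , slice 𝓢 (proj₂ (splitCoef (products s) (concatMap products 𝓢) x)) j

      lin-slice : ∀ 𝓢 x a j → lin 𝓢 (slice 𝓢 x j) a ≈ lin (concatMap products 𝓢) x (a , j)
      lin-slice []      x a j = refl
      lin-slice (s ∷ 𝓢) x a j = sym (trans (lin-splitCoef (products s) (concatMap products 𝓢) x (a , j))
        (+-cong (lin-products s (proj₁ (splitCoef (products s) (concatMap products 𝓢) x)) a j)
                (sym (lin-slice 𝓢 (proj₂ (splitCoef (products s) (concatMap products 𝓢) x)) a j))))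

      -- If all rows vanish, then so does, for each `s`, the whole vector of `M₂ l K`, and
      -- independence of `𝓙 l K` applies.
      slice-null : ∀ 𝓢 x → (∀ j → Null 𝓢 (slice 𝓢 x j)) → Null (concatMap products 𝓢) x
      slice-null []      x null = _
      slice-null (s ∷ 𝓢) x null = splitCoef-null (products s) (concatMap products 𝓢) x
        (unmapCoef-null (ψ n k s) (𝓙 l K) _ (Basis.independent (𝓙-basis l K) _ λ where
          ⟨ i , j ⟩ → proj₁ (null j) i))
        (slice-null 𝓢 _ (λ j → proj₂ (null j)))
        where l = proj₁ s

      -- The reverse of `slice`: for each `s` the rows are stacked into one vector of `M₂ l K`,
      -- which is expanded in `𝓙 l K`.
      assemble : ∀ 𝓢 → (Fin (suc K) → Coef 𝓢) → Coef (concatMap products 𝓢)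
      assemble []      _ = _
      assemble (s ∷ 𝓢) x = appendCoef (products s) (concatMap products 𝓢)
        (mapCoef (ψ n k s) (𝓙 l K) (proj₁ (Basis.spanning (𝓙-basis l K) λ where ⟨ i , j ⟩ → proj₁ (x j) i)))
        (assemble 𝓢 (λ j → proj₂ (x j)))
        where l = proj₁ s

      lin-assemble : ∀ 𝓢 x a j → lin (concatMap products 𝓢) (assemble 𝓢 x) (a , j) ≈ lin 𝓢 (x j) a
      lin-assemble []      x a j = refl
      lin-assemble (s ∷ 𝓢) x a j = trans
        (lin-appendCoef (products s) (concatMap products 𝓢) (mapCoef (ψ n k s) (𝓙 l K) y) _ (a , j))
        (+-cong (trans (sym (extend-lin W Q (ψ-image n k s) (𝓙 l K) y (a , j)))
                  (trans (ψ-formula n k s (lin (𝓙 l K) y) a j)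
                    (sum-cong-≋ {x = λ i → lin (𝓙 l K) y ⟨ i , j ⟩ * proj₂ s i a}
                       {y = λ i → proj₁ (x j) i * proj₂ s i a}
                      (λ i → *-congʳ (proj₂ (Basis.spanning (𝓙-basis l K) w) ⟨ i , j ⟩)))))
                (lin-assemble 𝓢 (λ j → proj₂ (x j)) a j))
        where
        l = proj₁ s
        W = M₂ l K

        w : V W
        w ⟨ i , j ⟩ = proj₁ (x j) i

        y = proj₁ (Basis.spanning (𝓙-basis l K) w)

      products-basis : ∀ {𝓢} → Basis 𝓢 → Basis (concatMap products 𝓢)
      products-basis {𝓢} basis = record
        { independent = λ x x≋0 → slice-null 𝓢 x λ j →
            independent (slice 𝓢 x j) (λ a → trans (lin-slice 𝓢 x a j) (x≋0 (a , j)))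
        ; spanning = λ v → assemble 𝓢 (λ j → proj₁ (spanning (λ a → v (a , j)))) ,
            λ (a , j) → trans (lin-assemble 𝓢 (λ j → proj₁ (spanning (λ a → v (a , j)))) a j)
                              (proj₂ (spanning (λ a → v (a , j))) a)
        }
        where open Basis basis

    -- The collection `𝓛`

    𝓛-basis : ∀ n k → Basis (𝓛 n k)
    𝓛-basis zero    k = basis-standard (M 1 k) (tt ,_) (λ _ → ≡.refl) (λ (_ , i) → i , ≡.refl) (U-M1 k)
    𝓛-basis (suc n) k = products-basis (suc n) k (𝓛-basis n (init k))

    𝓛-chains : ∀ n k → All (Chain (M (suc n) k) (total (suc n) k)) (𝓛 n k)
    𝓛-chains zero    k =
      chain-standard (M 1 k) (tt ,_) (λ _ → ≡.refl) (λ (_ , i) → i , ≡.refl) (U-M1 k) ∷ []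
    𝓛-chains (suc n) k = All.concat⁺ (All.map⁺ (All.map
      (λ {s} ch → All.map⁺ (All.map (ψ-chain (suc n) k s ch) (𝓙-chains (proj₁ s) (last k))))
      (𝓛-chains n (init k))))

    𝓛-integral : ∀ n k → All (IsIntegralSeq (M (suc n) k)) (𝓛 n k)
    𝓛-integral zero    k = (λ i x → integral-ind (_≟_ (M 1 k) (tt , i) x)) ∷ []
    𝓛-integral (suc n) k = All.concat⁺ (All.map⁺ (All.map
      (λ {s} vℤ → All.map⁺ (All.map (λ wℤ i → ψ-integral (suc n) k s vℤ (wℤ i)) (𝓙-integral (proj₁ s) (last k))))
      (𝓛-integral n (init k))))

    𝓛-isSymmetricJordanBasis : ¬ (1# ≈ 0#) → ∀ n k → IsSymmetricJordanBasis (M (suc n) k) (𝓛 n k)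
    𝓛-isSymmetricJordanBasis 1≉0 n k = record
      { chains = All.zipWith (λ {s} (v≉0 , ch) → Chain⇒IsSymmetricJordanChain {s = s} v≉0
          (subst (λ d → Chain (M (suc n) k) d s) (≡.sym (maxRank-M (suc n) k)) ch))
          (independent⇒nonzero {M (suc n) k} 1≉0 (𝓛 n k) (Basis.independent (𝓛-basis n k)) , 𝓛-chains n k)
      ; basis = Basis⇒IsBasis (M (suc n) k) (𝓛-basis n k)
      }

    𝓛-terms-integral : ∀ n k → All (IsIntegral (M (suc n) k)) (concatMap terms (𝓛 n k))
    𝓛-terms-integral n k = All.concat⁺ (All.map⁺ (All.map All.tabulate⁺ (𝓛-integral n k)))

theorem1p1 : ∀ {c ℓ₁ ℓ₂} (K : HeytingField c ℓ₁ ℓ₂) → CharacteristicZero K →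
    (n : ℕ) (k : Vector ℕ (suc n)) →
    let open BTK (scalars K) in
    IsSymmetricJordanBasis (M (suc n) k) (𝓛 n k)
    × All (IsIntegral (M (suc n) k)) (concatMap terms (𝓛 n k))
theorem1p1 K char0 n k = 𝓛-isSymmetricJordanBasis 1≉0 n k , 𝓛-terms-integral n k
  where
  open HeytingField K
  open BTK (scalars K) using (fromℕᴿ)
  open import Algebra.Properties.Ring (CommutativeRing.ring (scalars K)) using (-0#≈0#)

  -- `#⇒invertible` inverts the difference of two apart elements, here `x - 0#`.
  x-0 : ∀ x → x - 0# ≈ x
  x-0 x = trans (+-congˡ -0#≈0#) (+-identityʳ x)

  ι : ℕ → Carrier
  ι m = proj₁ (#⇒invertible (char0 m))

  ι-inverse : ∀ m → ι m * fromℕᴿ (suc m) ≈ 1#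
  ι-inverse m = trans (*-congˡ (sym (x-0 (fromℕᴿ (suc m))))) (proj₁ (proj₂ (#⇒invertible (char0 m))))

  1≉0 : ¬ (1# ≈ 0#)
  -- `fromℕᴿ 1` unfolds to `1# + 0#`, and `char0 0` says that this is apart from `0#`.
  1≉0 1≈0 = #-irrefl (trans (+-identityʳ 1#) 1≈0) (char0 0)

  open LinearBTK.WithInverses (scalars K) ι ι-inverse
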